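{- Let $r\geq 3$, $k\geq 1$, $t\geq 1$ be integers. If $r\in\{3,4\}$ then \[ n_0(k,r,t)\leq (2.5\,t)^{\frac{1}{r-1}}(k-t)+k, \] and if $r\geq 5$ then \[ n_0(k,r,t)\leq (2t)^{\frac{1}{r-1}}(k-t)+k. \] Equivalently: for every integer $n\geq (2.5t)^{1/(r-1)}(k-t)+k$ (when $r\in\{3,4\}$), respectively $n\geq (2t)^{1/(r-1)}(k-t)+k$ (when $r\geq 5$), every $r$-wise $t$-intersecting family $\mathcal{F}\subset\binom{[n]}{k}$ satisfies $|\mathcal{F}|\leq\binom{n-t}{k-t}$.
   Context: $[n]=\{1,\dots,n\}$ and $\binom{[n]}{k}$ is the set of $k$-element subsets of $[n]$. A family $\mathcal{F}$ of sets is $r$-wise $t$-intersecting if $|F_1\cap\dots\cap F_r|\geq t$ for all (not necessarily distinct) $F_1,\dots,F_r\in\mathcal{F}$. $n_0(k,r,t)$ denotes the minimal integer $n_0$ such that for all $n\geq n_0$ and all $r$-wise $t$-intersecting families $\mathcal{F}\subset\binom{[n]}{k}$ one has $|\mathcal{F}|\leq\binom{n-t}{k-t}$ (the size of the full $t$-star, i.e. of all $k$-subsets of $[n]$ containing a fixed $t$-set). -}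

module Defs where

open import Data.Nat using (ℕ; _+_; _*_; _∸_; _^_; _≤_; _<_; _≤?_)
open import Data.Nat.Combinatorics using (_C_)
open import Data.Fin using (Fin)
open import Data.Fin.Subset using (Subset; ⋂; ∣_∣)
open import Data.List using (List; tabulate; length)
open import Data.List.Membership.Propositional using (_∈_)
open import Data.List.Relation.Unary.All using (All)
open import Data.List.Relation.Unary.Unique.Propositional using (Unique)
open import Data.Product using (_×_)
open import Data.Sum using (_⊎_)
open import Relation.Nullary using (yes; no)
open import Relation.Binary.PropositionalEquality using (_≡_)

IsKFamily : (n k : ℕ) → List (Subset n) → Set
IsKFamily n k 𝓕 = Unique 𝓕 × All (λ F → ∣ F ∣ ≡ k) 𝓕

RWiseTIntersecting : {n : ℕ} (r t : ℕ) → List (Subset n) → Set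
RWiseTIntersecting {n} r t 𝓕 =
  (Fs : Fin r → Subset n) → (∀ i → Fs i ∈ 𝓕) → t ≤ ∣ ⋂ (tabulate Fs) ∣

-- Size of the full t-star: binom(n-t, k-t), with the standard convention
-- that it is 0 when k < t (negative lower index).
starSize : (n k t : ℕ) → ℕ
starSize n k t with t ≤? k
... | yes _ = (n ∸ t) C (k ∸ t)
... | no  _ = 0

-- AboveThreshold a b r t k n  ⇔  the real inequality
--   n ≥ ((a·t)/b)^(1/(r-1)) · (k - t) + k     (assuming r ≥ 2, a,b,t > 0),
-- rewritten without real numbers by raising to the power r-1:
--  * if t ≤ k:  n ≥ k  and  (a·t)·(k-t)^(r-1) ≤ b·(n-k)^(r-1);
--  * if k < t:  n ≥ k  or   b·(k-n)^(r-1) ≤ (a·t)·(t-k)^(r-1).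
AboveThreshold : (a b r t k n : ℕ) → Set
AboveThreshold a b r t k n =
  (t ≤ k → k ≤ n × a * t * (k ∸ t) ^ (r ∸ 1) ≤ b * (n ∸ k) ^ (r ∸ 1))
  × (k < t → k ≤ n ⊎ b * (k ∸ n) ^ (r ∸ 1) ≤ a * t * (t ∸ k) ^ (r ∸ 1))

{-# OPTIONS --safe #-}
-- After compression the family f is shifted.  Write l = k - t, m = n - k and r = j + 1,
-- and read a member from left to right as a lattice word whose level starts at t, drops
-- by 1 at each element and rises by j at each non-element.  Being r-wise t-intersecting
-- forces the level of every member to reach 0, so there are at most C(m+l, l) + E members,
-- the first term counting the words of the star (those that start with t ones).
--
-- The excess E is paid for by absent star members.  Let a prefix w, not all ones, first
-- bring the level to 0, and let G be a star set 1…10G″ whose tail G″ never reaches level 0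
-- from level j.  Trading elements of j shifted copies of the members that start with w
-- shows that the tails of these members meet the tail of G if G lies in f.  By double
-- counting of disjoint pairs the density of f after each w is then at most M / K, where M
-- is the number of star sets outside f and K the number of admissible G.  Hence
-- |f| ≤ C(m+l, l) as soon as E ≤ K.
--
-- Let a / b be the constant 5/2 or 2, and β = 1 + b / (a t).  At most β^s C(m+l, l) words
-- with l + s ones and m zeros bring the level from s to 0; summing a geometric series, E ≤ K
-- follows from the hypothesis on n and β^(t+1) ≤ 2, which holds for t ≥ 2.
-- For t = 1 the hypothesis gives n ≥ 2 k or l = m = 0, and the Erdős–Ko–Rado theorem applies.
module Submission where

open import Defs
open import Data.Nat
open import Data.Nat.Properties
open import Data.Nat.Combinatorics
  using (_C_; nCk+nC[k+1]≡[n+1]C[k+1]; nCn≡1; k>n⇒nCk≡0; nCk≡nC[n∸k])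
open import Data.Nat.Tactic.RingSolver using (solve-∀)
open import Data.Bool using (Bool; true; false; not; _∧_; _∨_; if_then_else_)
import Data.Bool.Properties as Bool
open import Data.Empty using (⊥-elim)
open import Data.Fin using (Fin; zero; suc)
open import Data.Fin.Properties using (any?)
open import Data.Fin.Subset using (Subset; ∣_∣; _∩_; ⊤; ⋂)
open import Data.Fin.Subset.Properties
  using (∩-comm; ∩-assoc; ∩-identityʳ; ∩-identityˡ; ∩-idem)
open import Data.List using (List; []; _∷_; length; tabulate)
open import Data.List.Membership.Propositional using (_∈_)
open import Data.List.Relation.Unary.All using ([]; _∷_)
open import Data.List.Relation.Unary.All.Properties using (All¬⇒¬Any)
open import Data.List.Relation.Unary.AllPairs using ([]; _∷_)
open import Data.List.Relation.Unary.Any using (here; there)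
open import Data.Product using (_×_; _,_; proj₁; proj₂; ∃)
open import Data.Sum using (_⊎_; inj₁; inj₂)
import Data.Unit as Unit
open import Data.Vec using ([]; _∷_; _∷ʳ_)
import Data.Vec.Properties as Vec
open import Relation.Nullary using (¬_; yes; no; does)
open import Relation.Nullary.Decidable using (dec-true; dec-false)
open import Relation.Binary.PropositionalEquality

-- Families and their cross-intersections

Family : ℕ → Set
Family n = Subset n → Bool

infix 4 _∋_
_∋_ : ∀ {n} → Family n → Subset n → Set
f ∋ F = f F ≡ true

infixl 8 _↾_
_↾_ : ∀ {n} → Family (suc n) → Bool → Family n
(f ↾ b) F = f (b ∷ F)

compl : ∀ {n} → Family n → Family n
compl f F = not (f F)

-- Recursion on the first coordinate follows Pascal's rule, so that bounds can be proved by
-- splitting a family into its two restrictions.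
cnt : ∀ {n} → ℕ → Family n → ℕ
cnt {zero}  zero    f = if f [] then 1 else 0
cnt {zero}  (suc k) f = 0
cnt {suc n} zero    f = cnt 0 (f ↾ false)
cnt {suc n} (suc k) f = cnt k (f ↾ true) + cnt (suc k) (f ↾ false)

+-swap₄ : ∀ a b c d → a + b + (c + d) ≡ a + c + (b + d)
+-swap₄ = solve-∀

+-swap₃ : ∀ x y z → x + (y + z) ≡ y + (x + z)
+-swap₃ = solve-∀

cnt-compl : ∀ {n} k (f : Family n) → cnt k f + cnt k (compl f) ≡ n C k
cnt-compl {zero} zero f with f []
... | true  = refl
... | false = refl
cnt-compl {zero} (suc k) f = sym (k>n⇒nCk≡0 {0} {suc k} (s≤s z≤n))
cnt-compl {suc n} zero f = cnt-compl {n} zero (f ↾ false)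
cnt-compl {suc n} (suc k) f = begin
  a + b + (c + d)      ≡⟨ +-swap₄ a b c d ⟩
  (a + c) + (b + d)    ≡⟨ cong₂ _+_ (cnt-compl k (f ↾ true)) (cnt-compl (suc k) (f ↾ false)) ⟩
  n C k + n C suc k    ≡⟨ nCk+nC[k+1]≡[n+1]C[k+1] n k ⟩
  suc n C suc k        ∎
  where
  open ≡-Reasoning
  a = cnt k (f ↾ true)
  b = cnt (suc k) (f ↾ false)
  c = cnt k (compl f ↾ true)
  d = cnt (suc k) (compl f ↾ false)

cnt≤C : ∀ {n} k (f : Family n) → cnt k f ≤ n C k
cnt≤C k f = ≤-trans (m≤m+n _ _) (≤-reflexive (cnt-compl k f))

-- The `j` members, possibly equal, are intersected into `X` one after another, so that an induction
-- on `j` can treat each of them in turn. With `X` = `⊤` this is the `j`-wise `c`-intersecting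
-- property.
Cross : ∀ {n} → ℕ → ℕ → Family n → Subset n → Set
Cross zero    c f X = c ≤ ∣ X ∣
Cross (suc j) c f X = ∀ F → f ∋ F → Cross j c f (F ∩ X)

data Remove : ∀ {n} → Subset n → Subset n → Set where
  here  : ∀ {n} {X : Subset n} → Remove (true ∷ X) (false ∷ X)
  there : ∀ {n b} {X Y : Subset n} → Remove X Y → Remove (b ∷ X) (b ∷ Y)

Shifted : ∀ {n} → Family n → Set
Shifted {zero}        f = Unit.⊤
Shifted {suc zero}    f = Unit.⊤
Shifted {suc (suc n)} f =
  (∀ F → f ∋ false ∷ true ∷ F → f ∋ true ∷ false ∷ F) × (∀ b → Shifted (f ↾ b))

shifted-↾ : ∀ {n} {f : Family (suc n)} → Shifted f → ∀ b → Shifted (f ↾ b)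
shifted-↾ {zero}  sh b = Unit.tt
shifted-↾ {suc n} sh b = proj₂ sh b

-- A chain of adjacent trades. When an element of the set is in the way, it moves to the front
-- itself and the removed one takes its place.
shifted-remove : ∀ {n} {f : Family (suc n)} → Shifted f →
  ∀ {X Y} → Remove X Y → f ∋ false ∷ X → f ∋ true ∷ Y
shifted-remove {suc n} (s , _) here fX = s _ fX
shifted-remove {suc n} (s , sb) (there {b = true} r) fX =
  shifted-remove (sb true) r (s _ fX)
shifted-remove {suc n} (s , sb) (there {b = false} r) fX =
  s _ (shifted-remove (sb false) r fX)

∣remove∣ : ∀ {n} {X Y : Subset n} → Remove X Y → ∣ X ∣ ≡ suc ∣ Y ∣
∣remove∣ here = refl
∣remove∣ (there {b = true} r)  = cong suc (∣remove∣ r)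
∣remove∣ (there {b = false} r) = ∣remove∣ r

removable : ∀ {n} (X : Subset n) → 1 ≤ ∣ X ∣ → ∃ λ Y → Remove X Y
removable (true ∷ X)  p = _ , here
removable (false ∷ X) p with removable X p
... | Y , r = _ , there r

remove-∩ʳ : ∀ {n} (F X : Subset n) {Y} → Remove (F ∩ X) Y →
  ∃ λ X′ → Remove X X′ × Y ≡ F ∩ X′
remove-∩ʳ (true ∷ F) (true ∷ X) here = _ , here , refl
remove-∩ʳ (b ∷ F) (c ∷ X) (there r) with remove-∩ʳ F X r
... | X′ , r′ , refl = _ , there r′ , refl

remove-∩ˡ : ∀ {n} (F X : Subset n) {Y} → Remove (F ∩ X) Y →
  ∃ λ F′ → Remove F F′ × Y ≡ F′ ∩ X
remove-∩ˡ F X {Y} r with remove-∩ʳ X F (subst (λ Z → Remove Z Y) (∩-comm F X) r)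
... | F′ , r′ , e = F′ , r′ , trans e (∩-comm X F′)

-- The bound for `X` itself makes every intersection nonempty, so that an element can be removed.
-- The removal is induced by one from `X`, after which `suc d` elements are still left; hence there
-- was one more before.
cross-remove : ∀ {n} j {d} {f : Family n} {X} → Cross j (suc d) f X →
  (∀ {Y} → Remove X Y → Cross j (suc d) f Y) → Cross j (suc (suc d)) f X
cross-remove zero {d} {f} {X} cX cY with removable X (≤-trans (s≤s z≤n) cX)
... | Y , r = subst (suc (suc d) ≤_) (sym (∣remove∣ r)) (s≤s (cY r))
cross-remove (suc j) {X = X} cX cY F fF = cross-remove j (cX F fF) step
  where
  step : ∀ {Y} → Remove (F ∩ X) Y → Cross j _ _ Y
  step r with remove-∩ʳ F X r
  ... | X′ , r′ , refl = cY r′ F fF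

cross-11 : ∀ {n} j {c} {f : Family (suc n)} {X} → Cross j (suc c) f (true ∷ X) →
  Cross j c (f ↾ true) X
cross-11 zero    p      = s≤s⁻¹ p
cross-11 (suc j) p F fF = cross-11 j (p (true ∷ F) fF)

cross-10 : ∀ {n} j {c} {f : Family (suc n)} {X} → Cross j c f (false ∷ X) →
  Cross j c (f ↾ true) X
cross-10 zero    p      = p
cross-10 (suc j) p F fF = cross-10 j (p (true ∷ F) fF)

-- The first coordinate of the fixed set is outside, so each of the j members
-- may be traded for one that contains it at the cost of one common element.
cross-00 : ∀ {n} j {c} {f : Family (suc n)} {X} → Shifted f →
  Cross j (suc c) f (false ∷ X) → Cross j (suc (j + c)) (f ↾ false) X
cross-00 zero    sh p = p
cross-00 (suc j) {X = X} sh p F fF =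
  cross-remove j (cross-00 j sh (p (false ∷ F) fF)) step
  where
  step : ∀ {Y} → Remove (F ∩ X) Y → Cross j _ _ Y
  step r with remove-∩ˡ F X r
  ... | F′ , r′ , refl = cross-00 j sh (p (true ∷ F′) (shifted-remove sh r′ fF))

-- The first member misses the first coordinate and takes over the role of the fixed set in
-- `cross-00`. Only the other `j` members are traded, which is why the gain is `j`.
cross-01 : ∀ {n} j {c} {f : Family (suc n)} {X} → Shifted f →
  Cross (suc j) (suc c) f (true ∷ X) → Cross (suc j) (suc (j + c)) (f ↾ false) X
cross-01 j sh p F fF = cross-00 j sh (p (false ∷ F) fF)

cnt>n : ∀ {n k} (f : Family n) → n < k → cnt k f ≡ 0
cnt>n {n} {k} f n<k = n≤0⇒n≡0 (subst (cnt k f ≤_) (k>n⇒nCk≡0 n<k) (cnt≤C k f))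

-- Truncated subtraction can break Pascal's rule when n ≤ k, but then the factor `cnt (suc k) f` is
-- 0.
cnt-pascal : ∀ {n} k j (f : Family n) →
  cnt (suc k) f * ((n ∸ k) C suc j)
    ≡ cnt (suc k) f * ((n ∸ suc k) C j) + cnt (suc k) f * ((n ∸ suc k) C suc j)
cnt-pascal {n} k j f with n <? suc k
... | yes n<1+k rewrite cnt>n f n<1+k = refl
... | no  n≮1+k = begin
  c * ((n ∸ k) C suc j)                         ≡⟨ cong (λ i → c * (i C suc j)) (+-∸-assoc 1 (≮⇒≥ n≮1+k)) ⟩
  c * (suc (n ∸ suc k) C suc j)                 ≡⟨ cong (c *_) (nCk+nC[k+1]≡[n+1]C[k+1] (n ∸ suc k) j) ⟨
  c * ((n ∸ suc k) C j + (n ∸ suc k) C suc j)   ≡⟨ *-distribˡ-+ c _ _ ⟩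
  c * ((n ∸ suc k) C j) + c * ((n ∸ suc k) C suc j) ∎
  where
  open ≡-Reasoning
  c = cnt (suc k) f

-- Both sides bound the number of pairs of disjoint F ∈ f and G ∈ h from below
-- and above.
cnt-disjoint : ∀ {n} ρ κ (f h : Family n) →
  (∀ F G → ∣ F ∣ ≡ ρ → ∣ G ∣ ≡ κ → f ∋ F → ∣ F ∩ G ∣ ≡ 0 → h ∋ G) →
  cnt ρ f * ((n ∸ ρ) C κ) ≤ cnt κ h * ((n ∸ κ) C ρ)
cnt-disjoint {zero} zero zero f h p with f [] in eq
... | false = z≤n
... | true rewrite p [] [] refl refl eq refl = ≤-refl
cnt-disjoint {zero} zero (suc κ) f h p =
  ≤-reflexive (trans (cong (cnt 0 f *_) (k>n⇒nCk≡0 {0} {suc κ} z<s)) (*-zeroʳ (cnt 0 f)))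
cnt-disjoint {zero} (suc ρ) κ f h p = z≤n
cnt-disjoint {suc n} zero zero f h p =
  cnt-disjoint {n} zero zero (f ↾ false) (h ↾ false) (λ F G e e′ → p (false ∷ F) (false ∷ G) e e′)
cnt-disjoint {suc n} (suc ρ) zero f h p = begin
  (f₁ + f₀) * 1                        ≡⟨ *-distribʳ-+ 1 f₁ f₀ ⟩
  f₁ * 1 + f₀ * 1                      ≤⟨ +-mono-≤
    (cnt-disjoint ρ 0 (f ↾ true) (h ↾ false) (λ F G e e′ → p (true ∷ F) (false ∷ G) (cong suc e) e′))
    (cnt-disjoint (suc ρ) 0 (f ↾ false) (h ↾ false) (λ F G e e′ → p (false ∷ F) (false ∷ G) e e′)) ⟩
  h₀ * (n C ρ) + h₀ * (n C suc ρ)      ≡⟨ *-distribˡ-+ h₀ _ _ ⟨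
  h₀ * (n C ρ + n C suc ρ)             ≡⟨ cong (h₀ *_) (nCk+nC[k+1]≡[n+1]C[k+1] n ρ) ⟩
  h₀ * (suc n C suc ρ)                 ∎
  where
  open ≤-Reasoning
  f₁ = cnt ρ (f ↾ true)
  f₀ = cnt (suc ρ) (f ↾ false)
  h₀ = cnt 0 (h ↾ false)
cnt-disjoint {suc n} zero (suc κ) f h p = begin
  f₀ * (suc n C suc κ)                 ≡⟨ cong (f₀ *_) (nCk+nC[k+1]≡[n+1]C[k+1] n κ) ⟨
  f₀ * (n C κ + n C suc κ)             ≡⟨ *-distribˡ-+ f₀ _ _ ⟩
  f₀ * (n C κ) + f₀ * (n C suc κ)      ≤⟨ +-mono-≤
    (cnt-disjoint 0 κ (f ↾ false) (h ↾ true) (λ F G e e′ → p (false ∷ F) (true ∷ G) e (cong suc e′)))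
    (cnt-disjoint 0 (suc κ) (f ↾ false) (h ↾ false) (λ F G e e′ → p (false ∷ F) (false ∷ G) e e′)) ⟩
  h₁ * 1 + h₀ * 1                      ≡⟨ *-distribʳ-+ 1 h₁ h₀ ⟨
  (h₁ + h₀) * 1                        ∎
  where
  open ≤-Reasoning
  f₀ = cnt 0 (f ↾ false)
  h₁ = cnt κ (h ↾ true)
  h₀ = cnt (suc κ) (h ↾ false)
cnt-disjoint {suc n} (suc ρ) (suc κ) f h p = begin
  (f₁ + f₀) * ((n ∸ ρ) C suc κ)
    ≡⟨ *-distribʳ-+ _ f₁ f₀ ⟩
  f₁ * ((n ∸ ρ) C suc κ) + f₀ * ((n ∸ ρ) C suc κ)
    ≡⟨ cong (f₁ * ((n ∸ ρ) C suc κ) +_) (cnt-pascal ρ κ (f ↾ false)) ⟩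
  f₁ * ((n ∸ ρ) C suc κ) + (f₀ * ((n ∸ suc ρ) C κ) + f₀ * ((n ∸ suc ρ) C suc κ))
    ≤⟨ +-mono-≤
         (cnt-disjoint ρ (suc κ) (f ↾ true) (h ↾ false) (λ F G e e′ → p (true ∷ F) (false ∷ G) (cong suc e) e′))
         (+-mono-≤
           (cnt-disjoint (suc ρ) κ (f ↾ false) (h ↾ true) (λ F G e e′ → p (false ∷ F) (true ∷ G) e (cong suc e′)))
           (cnt-disjoint (suc ρ) (suc κ) (f ↾ false) (h ↾ false) (λ F G e e′ → p (false ∷ F) (false ∷ G) e e′))) ⟩
  x + (y + z)
    ≡⟨ +-swap₃ x y z ⟩
  y + (x + z)
    ≡⟨ cong (y +_) (cnt-pascal κ ρ (h ↾ false)) ⟨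
  h₁ * ((n ∸ κ) C suc ρ) + h₀ * ((n ∸ κ) C suc ρ)
    ≡⟨ *-distribʳ-+ _ h₁ h₀ ⟨
  (h₁ + h₀) * ((n ∸ κ) C suc ρ) ∎
  where
  open ≤-Reasoning
  f₁ = cnt ρ (f ↾ true)
  f₀ = cnt (suc ρ) (f ↾ false)
  h₁ = cnt κ (h ↾ true)
  h₀ = cnt (suc κ) (h ↾ false)
  x = h₀ * ((n ∸ suc κ) C ρ)
  y = h₁ * ((n ∸ κ) C suc ρ)
  z = h₀ * ((n ∸ suc κ) C suc ρ)

C-pos : ∀ {n k} → k ≤ n → 1 ≤ n C k
C-pos {n} {zero} _ = ≤-refl
C-pos {suc n} {suc k} (s≤s k≤n) = begin
  1                  ≤⟨ C-pos k≤n ⟩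
  n C k              ≤⟨ m≤m+n _ _ ⟩
  n C k + n C suc k  ≡⟨ nCk+nC[k+1]≡[n+1]C[k+1] n k ⟩
  suc n C suc k      ∎
  where open ≤-Reasoning

cnt-full : ∀ n k → cnt {n} k (λ _ → true) ≡ n C k
cnt-full zero    zero    = refl
cnt-full zero    (suc k) = sym (k>n⇒nCk≡0 {0} {suc k} z<s)
cnt-full (suc n) zero    = cnt-full n zero
cnt-full (suc n) (suc k) =
  trans (cong₂ _+_ (cnt-full n k) (cnt-full n (suc k))) (nCk+nC[k+1]≡[n+1]C[k+1] n k)

-- Either side counts the disjoint pairs of a `k`-set and an `l`-set, so `cnt-disjoint` applies to
-- the full families.
C*C-≤ : ∀ n k l → (n C k) * ((n ∸ k) C l) ≤ (n C l) * ((n ∸ l) C k)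
C*C-≤ n k l = subst₂ (λ x y → x * ((n ∸ k) C l) ≤ y * ((n ∸ l) C k)) (cnt-full n k) (cnt-full n l)
  (cnt-disjoint {n} k l (λ _ → true) (λ _ → true) (λ _ _ _ _ _ _ → refl))

-- A κ-set disjoint from a member of `f` lies outside `g`, so disjoint pairs can be double counted.
-- Read as densities: |f| / C(n, ρ) ≤ |compl g| / C(n, κ). The cancelled factor `p` counts the
-- ρ-sets disjoint from a given κ-set and is positive because κ + ρ ≤ n.
cnt-cross-intersecting : ∀ {n} ρ κ (f g : Family n) → κ + ρ ≤ n →
  (∀ F G → ∣ F ∣ ≡ ρ → ∣ G ∣ ≡ κ → f ∋ F → g ∋ G → 1 ≤ ∣ F ∩ G ∣) →
  cnt ρ f * (n C κ) ≤ cnt κ (compl g) * (n C ρ)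
cnt-cross-intersecting {n} ρ κ f g κ+ρ≤n meet = *-cancelʳ-≤ _ _ p {{>-nonZero p>0}} (begin
  x * (n C κ) * p                      ≡⟨ *-assoc x _ p ⟩
  x * ((n C κ) * p)                      ≤⟨ *-monoʳ-≤ x (C*C-≤ n κ ρ) ⟩
  x * ((n C ρ) * ((n ∸ ρ) C κ))          ≡⟨ lem₁ x _ _ ⟩
  x * ((n ∸ ρ) C κ) * (n C ρ)          ≤⟨ *-monoˡ-≤ (n C ρ) (cnt-disjoint ρ κ f (compl g) disj) ⟩
  y * p * (n C ρ)                      ≡⟨ lem₂ y p (n C ρ) ⟩
  y * (n C ρ) * p                      ∎)
  where
  open ≤-Reasoning
  x = cnt ρ f
  y = cnt κ (compl g)
  p = (n ∸ κ) C ρ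
  p>0 : 1 ≤ p
  p>0 = C-pos (m+n≤o⇒m≤o∸n ρ (subst (_≤ n) (+-comm κ ρ) κ+ρ≤n))
  lem₁ : ∀ x a b → x * (a * b) ≡ x * b * a
  lem₁ = solve-∀
  lem₂ : ∀ x a b → x * a * b ≡ x * b * a
  lem₂ = solve-∀
  disj : ∀ F G → ∣ F ∣ ≡ ρ → ∣ G ∣ ≡ κ → f ∋ F → ∣ F ∩ G ∣ ≡ 0 → compl g ∋ G
  disj F G eF eG fF e with g G in gG
  ... | false = refl
  ... | true  = ⊥-elim (<⇒≢ (meet F G eF eG fF gG) (sym e))

-- Trading excess words for star words

-- Words of length n with u ones, read from left to right: the level starts at t,
-- drops by 1 at each one and rises by j at each zero.  hit counts the words for
-- which the level reaches 0, nonhit the others.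
hit : ℕ → ℕ → ℕ → ℕ → ℕ
hit j n       zero    u       = n C u
hit j zero    (suc t) u       = 0
hit j (suc n) (suc t) zero    = hit j n (suc (j + t)) zero
hit j (suc n) (suc t) (suc u) = hit j n t u + hit j n (suc (j + t)) (suc u)

nonhit : ℕ → ℕ → ℕ → ℕ → ℕ
nonhit j n       zero    u       = 0
nonhit j zero    (suc t) zero    = 1
nonhit j zero    (suc t) (suc u) = 0
nonhit j (suc n) (suc t) zero    = nonhit j n (suc (j + t)) zero
nonhit j (suc n) (suc t) (suc u) = nonhit j n t u + nonhit j n (suc (j + t)) (suc u)

hit+nonhit : ∀ j n t u → hit j n t u + nonhit j n t u ≡ n C u
hit+nonhit j n       zero    u       = +-identityʳ _
hit+nonhit j zero    (suc t) zero    = refl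
hit+nonhit j zero    (suc t) (suc u) = sym (k>n⇒nCk≡0 {0} {suc u} z<s)
hit+nonhit j (suc n) (suc t) zero    = hit+nonhit j n (suc (j + t)) zero
hit+nonhit j (suc n) (suc t) (suc u) = trans
  (+-swap₄ (hit j n t u) _ (nonhit j n t u) _)
  (trans (cong₂ _+_ (hit+nonhit j n t u) (hit+nonhit j n (suc (j + t)) (suc u)))
         (nCk+nC[k+1]≡[n+1]C[k+1] n u))

nonhit≤C : ∀ j n t u → nonhit j n t u ≤ n C u
nonhit≤C j n t u = ≤-trans (m≤n+m _ _) (≤-reflexive (hit+nonhit j n t u))

-- Members may repeat: `F` is taken every time, and idempotence absorbs the copies.
cross-diag : ∀ {n} j {c} {f : Family n} {X F} → Cross (suc j) c f X → f ∋ F → c ≤ ∣ F ∩ X ∣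
cross-diag zero p fF = p _ fF
cross-diag (suc j) {c} {f} {X} {F} p fF = subst (λ Y → c ≤ ∣ Y ∣)
  (trans (sym (∩-assoc F F X)) (cong (_∩ X) (∩-idem F)))
  (cross-diag j {X = F ∩ X} (p F fF) fF)

cross-empty : ∀ j {c} {f : Family 0} {k} → Cross (suc j) (suc c) f ⊤ → cnt k f ≡ 0
cross-empty j {f = f} {zero} p with f [] in eq
... | false = refl
... | true  with () ← cross-diag j p eq
cross-empty j {k = suc k} p = refl

-- Four cases for the first letters of two words: the indices of `f` and `h` are the letter of the
-- first word, those of `p` and `m` the letter of the second.
*-mono₄ : ∀ {f₁ f₀ p₁ p₀ m₁ m₀ h₁ h₀} →
  f₁ * p₁ ≤ m₁ * h₁ → f₁ * p₀ ≤ m₀ * h₁ → f₀ * p₁ ≤ m₁ * h₀ → f₀ * p₀ ≤ m₀ * h₀ →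
  (f₁ + f₀) * (p₁ + p₀) ≤ (m₁ + m₀) * (h₁ + h₀)
*-mono₄ {f₁} {f₀} {p₁} {p₀} {m₁} {m₀} {h₁} {h₀} a b c d = begin
  (f₁ + f₀) * (p₁ + p₀)                          ≡⟨ expand f₁ f₀ p₁ p₀ ⟩
  f₁ * p₁ + f₁ * p₀ + f₀ * p₁ + f₀ * p₀          ≤⟨ +-mono-≤ (+-mono-≤ (+-mono-≤ a b) c) d ⟩
  m₁ * h₁ + m₀ * h₁ + m₁ * h₀ + m₀ * h₀          ≡⟨ collect m₁ m₀ h₁ h₀ ⟩
  (m₁ + m₀) * (h₁ + h₀)                          ∎
  where
  open ≤-Reasoning
  expand : ∀ a b c d → (a + b) * (c + d) ≡ a * c + a * d + b * c + b * d
  expand = solve-∀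
  collect : ∀ a b c d → a * c + b * c + a * d + b * d ≡ (a + b) * (c + d)
  collect = solve-∀

*-mono₂ : ∀ {x p₁ p₀ m₁ m₀ h} → x * p₁ ≤ m₁ * h → x * p₀ ≤ m₀ * h → x * (p₁ + p₀) ≤ (m₁ + m₀) * h
*-mono₂ {x} {p₁} {p₀} {m₁} {m₀} {h} a b =
  subst₂ _≤_ (sym (*-distribˡ-+ x p₁ p₀)) (sym (*-distribʳ-+ h m₁ m₀)) (+-mono-≤ a b)

*-mono₂′ : ∀ {f₁ f₀ p m h₁ h₀} → f₁ * p ≤ m * h₁ → f₀ * p ≤ m * h₀ → (f₁ + f₀) * p ≤ m * (h₁ + h₀)
*-mono₂′ {f₁} {f₀} {p} {m} {h₁} {h₀} a b =
  subst₂ _≤_ (sym (*-distribʳ-+ p f₁ f₀)) (sym (*-distribˡ-+ m h₁ h₀)) (+-mono-≤ a b)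

module _ (i : ℕ) where

  private
    j r : ℕ
    j = suc i
    r = suc j

  -- The digits in `level-11` to `level-00` are the next letters read off `f` and off `g`. A one
  -- lowers the level `a` or `d` by 1, a zero raises it by `j`, and `c` changes as in the `cross`
  -- lemma with the same digits. The invariant r c = d + j a of `trade` survives all four
  -- combinations.
  level-11 : ∀ c d a → r * suc c ≡ suc d + j * suc a → r * c ≡ d + j * a
  level-11 c d a e = +-cancelˡ-≡ r _ _ (trans (sym (*-suc r c)) (trans e (lem i d a)))
    where
    lem : ∀ i d a → suc d + suc i * suc a ≡ suc (suc i) + (d + suc i * a)
    lem = solve-∀

  level-01 : ∀ c d a → r * suc c ≡ suc d + j * suc a → r * suc (i + c) ≡ d + j * suc (j + a)
  level-01 c d a e = trans (lem₁ i c) (trans (cong (_+ suc (suc i) * i) e) (lem₂ i d a))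
    where
    lem₁ : ∀ i c → suc (suc i) * suc (i + c) ≡ suc (suc i) * suc c + suc (suc i) * i
    lem₁ = solve-∀
    lem₂ : ∀ i d a → suc d + suc i * suc a + suc (suc i) * i ≡ d + suc i * suc (suc i + a)
    lem₂ = solve-∀

  level-10 : ∀ c d a → r * suc c ≡ suc d + j * suc a → r * suc c ≡ suc (j + d) + j * a
  level-10 c d a e = trans e (lem i d a)
    where
    lem : ∀ i d a → suc d + suc i * suc a ≡ suc (suc i + d) + suc i * a
    lem = solve-∀

  level-00 : ∀ c d a → r * suc c ≡ suc d + j * suc a →
    r * suc (j + c) ≡ suc (j + d) + j * suc (j + a)
  level-00 c d a e = trans (lem₁ i c) (trans (cong (_+ suc (suc i) * suc i) e) (lem₂ i d a))
    where
    lem₁ : ∀ i c → suc (suc i) * suc (suc i + c) ≡ suc (suc i) * suc c + suc (suc i) * suc i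
    lem₁ = solve-∀
    lem₂ : ∀ i d a → suc d + suc i * suc a + suc (suc i) * suc i
      ≡ suc (suc i + d) + suc i * suc (suc i + a)
    lem₂ = solve-∀

  -- Concerns the inequality j κ + r u ≤ j n + a carried along in `trade`. A one in the first word
  -- lowers both sides by `r`, a zero changes neither, and a one in the second word lowers the left
  -- side further. At a = 0 the inequality gives κ + u ≤ n, the condition for double counting.
  room-1 : ∀ κ u n a → j * κ + r * suc u ≤ j * suc n + suc a → j * κ + r * u ≤ j * n + a
  room-1 κ u n a e = +-cancelˡ-≤ r _ _ (subst₂ _≤_ (lem₁ i κ u) (lem₂ i n a) e)
    where
    lem₁ : ∀ i κ u → suc i * κ + suc (suc i) * suc u ≡ suc (suc i) + (suc i * κ + suc (suc i) * u)
    lem₁ = solve-∀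
    lem₂ : ∀ i n a → suc i * suc n + suc a ≡ suc (suc i) + (suc i * n + a)
    lem₂ = solve-∀

  room-0 : ∀ {x} n a → x ≤ j * suc n + suc a → x ≤ j * n + suc (j + a)
  room-0 {x} n a e = subst (x ≤_) (lem i n a) e
    where
    lem : ∀ i n a → suc i * suc n + suc a ≡ suc i * n + suc (suc i + a)
    lem = solve-∀

  room-κ : ∀ {y} κ x → j * suc κ + x ≤ y → j * κ + x ≤ y
  room-κ κ x e = ≤-trans (+-monoˡ-≤ x (*-monoʳ-≤ j (n≤1+n κ))) e

  -- a is the level of the word read off f and d that of the word read off g.  The
  -- invariant r c = d + j a keeps c positive until a reaches 0, where f and g
  -- have become cross-intersecting.
  trade : ∀ n a u d κ c (f g : Family n) → Shifted f → Cross r a f ⊤ →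
    (∀ G → g ∋ G → Cross j c f G) → r * c ≡ d + j * a → j * κ + r * u ≤ j * n + a →
    cnt u f * nonhit j n d κ ≤ cnt κ (compl g) * hit j n a u
  trade n a u zero κ c f g sh cf cg e room = ≤-trans (≤-reflexive (*-zeroʳ (cnt u f))) z≤n
  trade n a u (suc d) κ zero f g sh cf cg e room with () ← trans (sym (*-zeroʳ r)) e
  trade n zero u (suc d) κ (suc c) f g sh cf cg e room = begin
    cnt u f * nonhit j n (suc d) κ    ≤⟨ *-monoʳ-≤ (cnt u f) (nonhit≤C j n (suc d) κ) ⟩
    cnt u f * (n C κ)                 ≤⟨ cnt-cross-intersecting u κ f g κ+u≤n meet ⟩
    cnt κ (compl g) * (n C u)         ∎
    where
    open ≤-Reasoning
    meet : ∀ F G → ∣ F ∣ ≡ u → ∣ G ∣ ≡ κ → f ∋ F → g ∋ G → 1 ≤ ∣ F ∩ G ∣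
    meet F G _ _ fF gG = ≤-trans (s≤s z≤n) (cross-diag i (cg G gG) fF)
    κ+u≤n : κ + u ≤ n
    κ+u≤n = *-cancelˡ-≤ j (begin
      j * (κ + u)       ≡⟨ *-distribˡ-+ j κ u ⟩
      j * κ + j * u     ≤⟨ +-monoʳ-≤ (j * κ) (*-monoˡ-≤ u (n≤1+n j)) ⟩
      j * κ + r * u     ≤⟨ room ⟩
      j * n + 0         ≡⟨ +-identityʳ _ ⟩
      j * n             ∎)
  trade zero (suc a) u (suc d) κ (suc c) f g sh cf cg e room
    rewrite cross-empty j {f = f} {k = u} cf = z≤n
  trade (suc n) (suc a) u (suc d) κ (suc c) f g sh cf cg e room = combine u κ room
    where
    f₁ = f ↾ true
    f₀ = f ↾ false
    g₁ = g ↾ true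
    g₀ = g ↾ false
    b11 : ∀ u κ → j * suc κ + r * suc u ≤ j * suc n + suc a →
      cnt u f₁ * nonhit j n d κ ≤ cnt κ (compl g₁) * hit j n a u
    b11 u κ room = trade n a u d κ c f₁ g₁ (shifted-↾ sh true) (cross-11 r cf)
      (λ G gG → cross-11 j (cg (true ∷ G) gG)) (level-11 c d a e)
      (room-1 κ u n a (room-κ κ _ room))
    b10 : ∀ u κ → j * κ + r * suc u ≤ j * suc n + suc a →
      cnt u f₁ * nonhit j n (suc (j + d)) κ ≤ cnt κ (compl g₀) * hit j n a u
    b10 u κ room = trade n a u (suc (j + d)) κ (suc c) f₁ g₀ (shifted-↾ sh true) (cross-11 r cf)
      (λ G gG → cross-10 j (cg (false ∷ G) gG)) (level-10 c d a e) (room-1 κ u n a room)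
    b01 : ∀ u κ → j * suc κ + r * u ≤ j * suc n + suc a →
      cnt u f₀ * nonhit j n d κ ≤ cnt κ (compl g₁) * hit j n (suc (j + a)) u
    b01 u κ room = trade n (suc (j + a)) u d κ (suc (i + c)) f₀ g₁ (shifted-↾ sh false)
      (cross-01 j sh cf) (λ G gG → cross-01 i sh (cg (true ∷ G) gG)) (level-01 c d a e)
      (room-0 n a (room-κ κ _ room))
    b00 : ∀ u κ → j * κ + r * u ≤ j * suc n + suc a →
      cnt u f₀ * nonhit j n (suc (j + d)) κ ≤ cnt κ (compl g₀) * hit j n (suc (j + a)) u
    b00 u κ room = trade n (suc (j + a)) u (suc (j + d)) κ (suc (j + c)) f₀ g₀
      (shifted-↾ sh false) (cross-01 j sh cf) (λ G gG → cross-00 j sh (cg (false ∷ G) gG))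
      (level-00 c d a e) (room-0 n a room)
    combine : ∀ u κ → j * κ + r * u ≤ j * suc n + suc a →
      cnt u f * nonhit j (suc n) (suc d) κ ≤ cnt κ (compl g) * hit j (suc n) (suc a) u
    combine zero zero room = b00 zero zero room
    combine zero (suc κ) room =
      *-mono₂ {x = cnt 0 f₀} {p₁ = nonhit j n d κ} {m₁ = cnt κ (compl g₁)}
        (b01 zero κ room) (b00 zero (suc κ) room)
    combine (suc u) zero room =
      *-mono₂′ {f₁ = cnt u f₁} {m = cnt 0 (compl g₀)} {h₁ = hit j n a u}
        (b10 u zero room) (b00 (suc u) zero room)
    combine (suc u) (suc κ) room =
      *-mono₄ {f₁ = cnt u f₁} {p₁ = nonhit j n d κ} {m₁ = cnt κ (compl g₁)} {h₁ = hit j n a u}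
        (b11 u κ room) (b10 u (suc κ) room) (b01 (suc u) κ room) (b00 (suc u) (suc κ) room)

  pad : ∀ {n} τ → Subset n → Subset (τ + suc n)
  pad zero    G = false ∷ G
  pad (suc τ) G = true ∷ pad τ G

  -- All sets of `g` share the prefix of τ ones and a zero, so only the first word branches. Just
  -- before that zero the second word has level 0, where `trade` would be vacuous; after it `trade`
  -- takes over at level `j`. Since τ < a, the level `a` stays positive until then.
  trade-pad : ∀ n τ a u κ c (f : Family (τ + suc n)) (g : Family n) → Shifted f → Cross r a f ⊤ →
    (∀ G → g ∋ G → Cross j c f (pad τ G)) → r * c ≡ τ + j * a → τ < a →
    j * κ + r * u ≤ j * (τ + suc n) + a →
    cnt u f * nonhit j n j κ ≤ cnt κ (compl g) * hit j (τ + suc n) a u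
  trade-pad n τ (suc a) u κ zero f g sh cf cg e τ<a room
    with () ← trans (sym (*-zeroʳ r)) (trans e (trans (cong (τ +_) (*-suc j a)) (+-suc τ _)))
  trade-pad n zero (suc a) u κ (suc c) f g sh cf cg e τ<a room = combine u room
    where
    b1 : ∀ u → j * κ + r * suc u ≤ j * suc n + suc a →
      cnt u (f ↾ true) * nonhit j n j κ ≤ cnt κ (compl g) * hit j n a u
    b1 u room = trade n a u j κ (suc c) (f ↾ true) g (shifted-↾ sh true) (cross-11 r cf)
      (λ G gG → cross-10 j (cg G gG)) (trans e (*-suc j a)) (room-1 κ u n a room)
    b0 : ∀ u → j * κ + r * u ≤ j * suc n + suc a →
      cnt u (f ↾ false) * nonhit j n j κ ≤ cnt κ (compl g) * hit j n (suc (j + a)) u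
    b0 u room = trade n (suc (j + a)) u j κ (suc (j + c)) (f ↾ false) g (shifted-↾ sh false)
      (cross-01 j sh cf) (λ G gG → cross-00 j sh (cg G gG))
      (trans (lem₁ i c) (trans (cong (_+ suc (suc i) * suc i) e) (lem₂ i a))) (room-0 n a room)
      where
      lem₁ : ∀ i c → suc (suc i) * suc (suc i + c) ≡ suc (suc i) * suc c + suc (suc i) * suc i
      lem₁ = solve-∀
      lem₂ : ∀ i a → suc i * suc a + suc (suc i) * suc i ≡ suc i + suc i * suc (suc i + a)
      lem₂ = solve-∀
    combine : ∀ u → j * κ + r * u ≤ j * suc n + suc a →
      cnt u f * nonhit j n j κ ≤ cnt κ (compl g) * hit j (suc n) (suc a) u
    combine zero    room = b0 zero room
    combine (suc u) room =
      *-mono₂′ {f₁ = cnt u (f ↾ true)} {m = cnt κ (compl g)} {h₁ = hit j n a u}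
        (b1 u room) (b0 (suc u) room)
  trade-pad n (suc τ) (suc a) u κ (suc c) f g sh cf cg e (s≤s τ<a) room = combine u room
    where
    b1 : ∀ u → j * κ + r * suc u ≤ j * suc (τ + suc n) + suc a →
      cnt u (f ↾ true) * nonhit j n j κ ≤ cnt κ (compl g) * hit j (τ + suc n) a u
    b1 u room = trade-pad n τ a u κ c (f ↾ true) g (shifted-↾ sh true) (cross-11 r cf)
      (λ G gG → cross-11 j (cg G gG)) (level-11 c τ a e) τ<a (room-1 κ u _ a room)
    b0 : ∀ u → j * κ + r * u ≤ j * suc (τ + suc n) + suc a →
      cnt u (f ↾ false) * nonhit j n j κ ≤ cnt κ (compl g) * hit j (τ + suc n) (suc (j + a)) u
    b0 u room = trade-pad n τ (suc (j + a)) u κ (suc (i + c)) (f ↾ false) g (shifted-↾ sh false)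
      (cross-01 j sh cf) (λ G gG → cross-01 i sh (cg G gG))
      (level-01 c τ a e) (m≤n⇒m≤1+n (≤-trans τ<a (m≤n+m a j))) (room-0 (τ + suc n) a room)
    combine : ∀ u → j * κ + r * u ≤ j * suc (τ + suc n) + suc a →
      cnt u f * nonhit j n j κ ≤ cnt κ (compl g) * hit j (suc (τ + suc n)) (suc a) u
    combine zero    room = b0 zero room
    combine (suc u) room =
      *-mono₂′ {f₁ = cnt u (f ↾ true)} {m = cnt κ (compl g)} {h₁ = hit j (τ + suc n) a u}
        (b1 u room) (b0 (suc u) room)

  star : ∀ {n} τ → Family (τ + n) → Family n
  star zero    f = f
  star (suc τ) f = star τ (f ↾ true)

  star-pad : ∀ {n} τ (f : Family (τ + suc n)) G → star τ f (false ∷ G) ≡ f (pad τ G)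
  star-pad zero    f G = refl
  star-pad (suc τ) f G = star-pad τ (f ↾ true) G

  -- Members with a zero at the current coordinate leave the star and are charged by `trade-pad`;
  -- the others are handled by induction. With terms moved across: (members off the star) · K ≤ M ·
  -- (hit - C(n + 1, l)).
  hit-trade : ∀ n l τ (f : Family (τ + suc n)) → Shifted f → Cross r τ f ⊤ →
    j * l + r * (τ + l) ≤ j * (τ + suc n) + τ →
    let K = nonhit j n j l
        M = cnt l (compl (star τ f ↾ false)) in
    cnt (τ + l) f * K + M * (suc n C l) ≤ cnt l (star τ f) * K + M * hit j (τ + suc n) τ (τ + l)
  hit-trade n l zero f sh cf room = ≤-refl
  hit-trade n l (suc τ) f sh cf room = begin
    (x₁ + x₀) * K + M * (suc n C l)        ≡⟨ lem x₁ x₀ K _ ⟩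
    x₁ * K + M * (suc n C l) + x₀ * K      ≤⟨ +-mono-≤ ih new ⟩
    s * K + M * h₁ + M * h₀                ≡⟨ +-assoc (s * K) (M * h₁) (M * h₀) ⟩
    s * K + (M * h₁ + M * h₀)              ≡⟨ cong (s * K +_) (*-distribˡ-+ M h₁ h₀) ⟨
    s * K + M * (h₁ + h₀)                  ∎
    where
    open ≤-Reasoning
    K = nonhit j n j l
    M = cnt l (compl (star (suc τ) f ↾ false))
    s = cnt l (star (suc τ) f)
    x₁ = cnt (τ + l) (f ↾ true)
    x₀ = cnt (suc (τ + l)) (f ↾ false)
    h₁ = hit j (τ + suc n) τ (τ + l)
    h₀ = hit j (τ + suc n) (suc (j + τ)) (suc (τ + l))
    lem : ∀ a b c d → (a + b) * c + d ≡ a * c + d + b * c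
    lem = solve-∀
    lem₁ : ∀ i τ l → suc i * l + suc (suc i) * (suc τ + l) ≡ suc (suc i) + (suc i * l + suc (suc i) * (τ + l))
    lem₁ = solve-∀
    lem₂ : ∀ i τ n → suc i * (suc τ + suc n) + suc τ ≡ suc (suc i) + (suc i * (τ + suc n) + τ)
    lem₂ = solve-∀
    ih : x₁ * K + M * (suc n C l) ≤ s * K + M * h₁
    ih = hit-trade n l τ (f ↾ true) (shifted-↾ sh true) (cross-11 r cf)
      (+-cancelˡ-≤ r _ _ (subst₂ _≤_ (lem₁ i τ l) (lem₂ i τ n) room))
    -- The star set itself serves as one of the `r` members, which leaves `j` of them.
    members : ∀ G → (star τ (f ↾ true) ↾ false) ∋ G → Cross j (suc τ) f (pad (suc τ) G)
    members G gG = subst (Cross j (suc τ) f) (∩-identityʳ _)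
      (cf (pad (suc τ) G) (trans (sym (star-pad τ (f ↾ true) G)) gG))
    lem₃ : ∀ i τ → suc (suc i) * suc (i + τ) ≡ τ + suc i * suc (suc i + τ)
    lem₃ = solve-∀
    new : x₀ * K ≤ M * h₀
    new = trade-pad n τ (suc (j + τ)) (suc (τ + l)) l (suc (i + τ)) (f ↾ false)
      (star τ (f ↾ true) ↾ false) (shifted-↾ sh false) (cross-01 j sh cf)
      (λ G gG → cross-01 i sh (members G gG))
      (lem₃ i τ) (s≤s (m≤n+m τ j)) (room-0 (τ + suc n) τ room)

  cnt-↾false : ∀ {n} k (f : Family (suc n)) → cnt k (f ↾ false) ≤ cnt k f
  cnt-↾false zero    f = ≤-refl
  cnt-↾false (suc k) f = m≤n+m _ _

  -- `few` is E ≤ K. With it, cancelling `K` in `hit-trade` shows that at most `M` members lie off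
  -- the star, while at least `M` star sets are absent from `f`.
  cnt≤star : ∀ n l t (f : Family (t + suc n)) → Shifted f → Cross r t f ⊤ →
    j * l + r * (t + l) ≤ j * (t + suc n) + t →
    hit j (t + suc n) t (t + l) ≤ suc n C l + nonhit j n j l → 1 ≤ nonhit j n j l →
    cnt (t + l) f ≤ suc n C l
  cnt≤star n l t f sh cf room few K≥1 = *-cancelʳ-≤ _ _ K {{>-nonZero K≥1}}
    (+-cancelʳ-≤ (M * (suc n C l)) _ _ (begin
      x * K + M * (suc n C l)                   ≤⟨ hit-trade n l t f sh cf room ⟩
      s * K + M * hit j (t + suc n) t (t + l)   ≤⟨ +-monoʳ-≤ (s * K) (*-monoʳ-≤ M few) ⟩
      s * K + M * (suc n C l + K)               ≡⟨ lem s K M (suc n C l) ⟩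
      (s + M) * K + M * (suc n C l)             ≤⟨ +-monoˡ-≤ (M * (suc n C l)) (*-monoˡ-≤ K s+M≤) ⟩
      (suc n C l) * K + M * (suc n C l)         ∎))
    where
    open ≤-Reasoning
    K = nonhit j n j l
    M = cnt l (compl (star t f ↾ false))
    s = cnt l (star t f)
    x = cnt (t + l) f
    lem : ∀ s K M c → s * K + M * (c + K) ≡ (s + M) * K + M * c
    lem = solve-∀
    s+M≤ : s + M ≤ suc n C l
    s+M≤ = ≤-trans (+-monoʳ-≤ s (cnt-↾false l (compl (star t f)))) (≤-reflexive (cnt-compl l (star t f)))

-- Shifting

_∪ᶠ_ _∩ᶠ_ : ∀ {n} → Family n → Family n → Family n
(f ∪ᶠ g) F = f F ∨ g F
(f ∩ᶠ g) F = f F ∧ g F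

insert₂ : ∀ {n} → Fin (suc n) → Bool → Bool → Subset n → Subset (suc (suc n))
insert₂ zero            a b F       = a ∷ b ∷ F
insert₂ {suc n} (suc i) a b (c ∷ F) = c ∷ insert₂ i a b F

shift : ∀ {n} → Fin (suc n) → Family (suc (suc n)) → Family (suc (suc n))
shift zero f (true  ∷ false ∷ F) = f (true ∷ false ∷ F) ∨ f (false ∷ true ∷ F)
shift zero f (false ∷ true  ∷ F) = f (true ∷ false ∷ F) ∧ f (false ∷ true ∷ F)
shift zero f (true  ∷ true  ∷ F) = f (true ∷ true ∷ F)
shift zero f (false ∷ false ∷ F) = f (false ∷ false ∷ F)
shift {suc n} (suc i) f (c ∷ F)  = shift i (f ↾ c) F

-- `new` sets arrive by the shift. A `kept` set stays because its image was a member already; both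
-- memberships are recorded so that either can serve as the preimage.
data ShiftView {n} (i : Fin (suc n)) (f : Family (suc (suc n))) : Subset (suc (suc n)) → Set where
  both    : ∀ F → f ∋ insert₂ i true true F → ShiftView i f (insert₂ i true true F)
  neither : ∀ F → f ∋ insert₂ i false false F → ShiftView i f (insert₂ i false false F)
  old     : ∀ F → f ∋ insert₂ i true false F → ShiftView i f (insert₂ i true false F)
  new     : ∀ F → f ∋ insert₂ i false true F → ShiftView i f (insert₂ i true false F)
  kept    : ∀ F → f ∋ insert₂ i true false F → f ∋ insert₂ i false true F →
            ShiftView i f (insert₂ i false true F)

shiftView : ∀ {n} i (f : Family (suc (suc n))) F → shift i f ∋ F → ShiftView i f F
shiftView zero f (true ∷ true ∷ F) p = both F p
shiftView zero f (false ∷ false ∷ F) p = neither F p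
shiftView zero f (true ∷ false ∷ F) p with f (true ∷ false ∷ F) in eq
... | true  = old F eq
... | false = new F p
shiftView zero f (false ∷ true ∷ F) p = kept F (Bool.∧-conicalˡ _ _ p) (Bool.∧-conicalʳ _ _ p)
shiftView {suc n} (suc i) f (c ∷ F) p with shiftView i (f ↾ c) F p
... | both G q    = both (c ∷ G) q
... | neither G q = neither (c ∷ G) q
... | old G q     = old (c ∷ G) q
... | new G q     = new (c ∷ G) q
... | kept G q q′ = kept (c ∷ G) q q′

insert₂-∩ : ∀ {n} i {a b a′ b′} (F G : Subset n) →
  insert₂ i a b F ∩ insert₂ i a′ b′ G ≡ insert₂ i (a ∧ a′) (b ∧ b′) (F ∩ G)
insert₂-∩ zero F G = refl
insert₂-∩ {suc n} (suc i) (c ∷ F) (d ∷ G) = cong (c ∧ d ∷_) (insert₂-∩ i F G)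

insert₂-⊤ : ∀ {n} i → insert₂ {n} i true true ⊤ ≡ ⊤
insert₂-⊤ zero = refl
insert₂-⊤ {suc n} (suc i) = cong (true ∷_) (insert₂-⊤ i)

∣insert₂∣-ff : ∀ {n} i a b (F : Subset n) → ∣ insert₂ i false false F ∣ ≤ ∣ insert₂ i a b F ∣
∣insert₂∣-ff zero true true   F = m≤n+m _ 2
∣insert₂∣-ff zero true false  F = m≤n+m _ 1
∣insert₂∣-ff zero false true  F = m≤n+m _ 1
∣insert₂∣-ff zero false false F = ≤-refl
∣insert₂∣-ff {suc n} (suc i) a b (true ∷ F)  = s≤s (∣insert₂∣-ff i a b F)
∣insert₂∣-ff {suc n} (suc i) a b (false ∷ F) = ∣insert₂∣-ff i a b F

∣insert₂∣-swap : ∀ {n} i (F : Subset n) → ∣ insert₂ i false true F ∣ ≤ ∣ insert₂ i true false F ∣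
∣insert₂∣-swap zero F = ≤-refl
∣insert₂∣-swap {suc n} (suc i) (true ∷ F)  = s≤s (∣insert₂∣-swap i F)
∣insert₂∣-swap {suc n} (suc i) (false ∷ F) = ∣insert₂∣-swap i F

-- The intersection of members of shift i f is compared with that of suitable
-- preimages in f.  As long as only members of f have been met, the alternative
-- preimages (each kept set replaced by its shifted partner) are followed as well:
-- they are the ones to use once a member outside f turns up.
module _ {n} (i : Fin (suc n)) {f : Family (suc (suc n))} where

  private
    via : ∀ j {c a b a′ b′} {F G : Subset n} → Cross (suc j) c f (insert₂ i a′ b′ G) →
      f ∋ insert₂ i a b F → Cross j c f (insert₂ i (a ∧ a′) (b ∧ b′) (F ∩ G))
    via j {c} {F = F} {G} p q = subst (Cross j c f) (insert₂-∩ i F G) (p _ q)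

    back : ∀ j {c a b a′ b′} {F G : Subset n} →
      Cross j c (shift i f) (insert₂ i (a ∧ a′) (b ∧ b′) (F ∩ G)) →
      Cross j c (shift i f) (insert₂ i a b F ∩ insert₂ i a′ b′ G)
    back j {c} {F = F} {G} = subst (Cross j c (shift i f)) (sym (insert₂-∩ i F G))

  -- The preimages met so far have nothing in common at the two positions, so any preimage will do
  -- for each later member.
  cross-shift-ff : ∀ j {c a b G} → Cross j c f (insert₂ i false false G) →
    Cross j c (shift i f) (insert₂ i a b G)
  cross-shift-ff zero p = ≤-trans p (∣insert₂∣-ff i _ _ _)
  cross-shift-ff (suc j) p F sF with shiftView i f F sF
  ... | both H q    = back j (cross-shift-ff j (via j p q))
  ... | neither H q = back j (cross-shift-ff j (via j p q))
  ... | old H q     = back j (cross-shift-ff j (via j p q))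
  ... | new H q     = back j (cross-shift-ff j (via j p q))
  ... | kept H q _  = back j (cross-shift-ff j (via j p q))

  -- Arises when a `new` member follows members that contain both positions: the preimages share the
  -- second position and their images the first.
  cross-shift-swap : ∀ j {c G} → Cross j c f (insert₂ i false true G) →
    Cross j c (shift i f) (insert₂ i true false G)
  cross-shift-swap zero p = ≤-trans p (∣insert₂∣-swap i _)
  cross-shift-swap (suc j) p F sF with shiftView i f F sF
  ... | both H q    = back j (cross-shift-swap j (via j p q))
  ... | neither H q = back j (cross-shift-ff j (via j p q))
  ... | old H q     = back j (cross-shift-ff j (via j p q))
  ... | new H q     = back j (cross-shift-swap j (via j p q))
  ... | kept H q _  = back j (cross-shift-ff j (via j p q))

  cross-shift-alt : ∀ j {c b b′ G} → Cross j c f (insert₂ i false b G) →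
    Cross j c f (insert₂ i b′ false G) → Cross j c (shift i f) (insert₂ i false b G)
  cross-shift-alt zero p p* = p
  cross-shift-alt (suc j) p p* F sF with shiftView i f F sF
  ... | both H q    = back j (cross-shift-alt j (via j p q) (via j p* q))
  ... | neither H q = back j (cross-shift-alt j (via j p q) (via j p* q))
  ... | old H q     = back j (cross-shift-alt j (via j p q) (via j p* q))
  ... | new H q     = back j (cross-shift-ff j (via j p* q))
  ... | kept H q q′ = back j (cross-shift-alt j (via j p q′) (via j p* q))

  cross-shift-tf : ∀ j {c G} → Cross j c f (insert₂ i true false G) →
    Cross j c (shift i f) (insert₂ i true false G)
  cross-shift-tf zero p = p
  cross-shift-tf (suc j) p F sF with shiftView i f F sF
  ... | both H q    = back j (cross-shift-tf j (via j p q))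
  ... | neither H q = back j (cross-shift-alt j (via j p q) (via j p q))
  ... | old H q     = back j (cross-shift-tf j (via j p q))
  ... | new H q     = back j (cross-shift-ff j (via j p q))
  ... | kept H q q′ = back j (cross-shift-alt j (via j p q′) (via j p q))

  cross-shift-tt : ∀ j {c G} → Cross j c f (insert₂ i true true G) →
    Cross j c (shift i f) (insert₂ i true true G)
  cross-shift-tt zero p = p
  cross-shift-tt (suc j) p F sF with shiftView i f F sF
  ... | both H q    = back j (cross-shift-tt j (via j p q))
  ... | neither H q = back j (cross-shift-alt j (via j p q) (via j p q))
  ... | old H q     = back j (cross-shift-tf j (via j p q))
  ... | new H q     = back j (cross-shift-swap j (via j p q))
  ... | kept H q q′ = back j (cross-shift-alt j (via j p q′) (via j p q))

cross-shift : ∀ {n} i j {c} {f : Family (suc (suc n))} → Cross j c f ⊤ → Cross j c (shift i f) ⊤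
cross-shift i j {c} {f} p = subst (Cross j c (shift i f)) (insert₂-⊤ i)
  (cross-shift-tt i j (subst (Cross j c f) (sym (insert₂-⊤ i)) p))

cnt-∪∩ : ∀ {n} k (f g : Family n) → cnt k (f ∪ᶠ g) + cnt k (f ∩ᶠ g) ≡ cnt k f + cnt k g
cnt-∪∩ {zero} zero f g with f [] | g []
... | true  | true  = refl
... | true  | false = refl
... | false | true  = refl
... | false | false = refl
cnt-∪∩ {zero} (suc k) f g = refl
cnt-∪∩ {suc n} zero f g = cnt-∪∩ zero (f ↾ false) (g ↾ false)
cnt-∪∩ {suc n} (suc k) f g = trans (+-swap₄ (cnt k ((f ↾ true) ∪ᶠ (g ↾ true))) _ _ _)
  (trans (cong₂ _+_ (cnt-∪∩ k (f ↾ true) (g ↾ true)) (cnt-∪∩ (suc k) (f ↾ false) (g ↾ false)))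
    (+-swap₄ (cnt k (f ↾ true)) _ _ _))

-- The shift replaces the restrictions of types 10 and 01 by their union and their intersection,
-- which have the same total size.
cnt-shift : ∀ {n} i k (f : Family (suc (suc n))) → cnt k (shift i f) ≡ cnt k f
cnt-shift zero zero f = refl
cnt-shift zero (suc zero) f =
  trans (sym (+-assoc (cnt 0 (tf ∪ᶠ ft)) (cnt 0 (tf ∩ᶠ ft)) (cnt 1 (f ↾ false ↾ false))))
    (trans (cong (_+ cnt 1 (f ↾ false ↾ false)) (cnt-∪∩ 0 tf ft)) (+-assoc (cnt 0 tf) _ _))
  where
  tf = f ↾ true ↾ false
  ft = f ↾ false ↾ true
cnt-shift zero (suc (suc k)) f = lem (cnt k (f ↾ true ↾ true)) _ _ _ _
  (cnt (suc (suc k)) (f ↾ false ↾ false)) (cnt-∪∩ (suc k) (f ↾ true ↾ false) (f ↾ false ↾ true))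
  where
  regroup : ∀ a b c d → (a + b) + (c + d) ≡ a + (b + c) + d
  regroup = solve-∀
  lem : ∀ a b c b′ c′ d → b + c ≡ b′ + c′ → (a + b) + (c + d) ≡ (a + b′) + (c′ + d)
  lem a b c b′ c′ d e = trans (regroup a b c d)
    (trans (cong (λ x → a + x + d) e) (sym (regroup a b′ c′ d)))
cnt-shift {suc n} (suc i) zero f = cnt-shift i zero (f ↾ false)
cnt-shift {suc n} (suc i) (suc k) f =
  cong₂ _+_ (cnt-shift i k (f ↾ true)) (cnt-shift i (suc k) (f ↾ false))

size : ∀ {n} → Family n → ℕ
size {zero}  f = if f [] then 1 else 0
size {suc n} f = size (f ↾ true) + size (f ↾ false)

-- A set outside at position p (counted from 0) contributes n ∸ 1 ∸ p, so that the
-- potential drops by 1 whenever an adjacent shift moves a set.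
potential : ∀ {n} → Family n → ℕ
potential {zero}  f = 0
potential {suc n} f = n * size (f ↾ false) + (potential (f ↾ true) + potential (f ↾ false))

size-∪∩ : ∀ {n} (f g : Family n) → size (f ∪ᶠ g) + size (f ∩ᶠ g) ≡ size f + size g
size-∪∩ {zero} f g with f [] | g []
... | true  | true  = refl
... | true  | false = refl
... | false | true  = refl
... | false | false = refl
size-∪∩ {suc n} f g = trans (+-swap₄ (size ((f ↾ true) ∪ᶠ (g ↾ true))) _ _ _)
  (trans (cong₂ _+_ (size-∪∩ (f ↾ true) (g ↾ true)) (size-∪∩ (f ↾ false) (g ↾ false)))
    (+-swap₄ (size (f ↾ true)) _ _ _))

potential-∪∩ : ∀ {n} (f g : Family n) →
  potential (f ∪ᶠ g) + potential (f ∩ᶠ g) ≡ potential f + potential g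
potential-∪∩ {zero} f g = refl
potential-∪∩ {suc n} f g = begin
  n * su + (u₁ + u₀) + (n * si + (v₁ + v₀))     ≡⟨ lem₁ n su si u₁ u₀ v₁ v₀ ⟩
  n * (su + si) + ((u₁ + v₁) + (u₀ + v₀))       ≡⟨ cong₂ (λ x y → n * x + y)
    (size-∪∩ (f ↾ false) (g ↾ false))
    (cong₂ _+_ (potential-∪∩ (f ↾ true) (g ↾ true)) (potential-∪∩ (f ↾ false) (g ↾ false))) ⟩
  n * (sf + sg) + ((p₁ + q₁) + (p₀ + q₀))       ≡⟨ lem₁ n sf sg p₁ p₀ q₁ q₀ ⟨
  n * sf + (p₁ + p₀) + (n * sg + (q₁ + q₀))     ∎
  where
  open ≡-Reasoning
  su = size ((f ↾ false) ∪ᶠ (g ↾ false))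
  si = size ((f ↾ false) ∩ᶠ (g ↾ false))
  sf = size (f ↾ false)
  sg = size (g ↾ false)
  u₁ = potential ((f ↾ true) ∪ᶠ (g ↾ true))
  u₀ = potential ((f ↾ false) ∪ᶠ (g ↾ false))
  v₁ = potential ((f ↾ true) ∩ᶠ (g ↾ true))
  v₀ = potential ((f ↾ false) ∩ᶠ (g ↾ false))
  p₁ = potential (f ↾ true)
  p₀ = potential (f ↾ false)
  q₁ = potential (g ↾ true)
  q₀ = potential (g ↾ false)
  lem₁ : ∀ n a b c d e h → n * a + (c + d) + (n * b + (e + h)) ≡ n * (a + b) + ((c + e) + (d + h))
  lem₁ = solve-∀

size-split : ∀ {n} (f g : Family n) → size g ≡ size (f ∩ᶠ g) + size (compl f ∩ᶠ g)
size-split {zero} f g with f [] | g []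
... | true  | true  = refl
... | true  | false = refl
... | false | true  = refl
... | false | false = refl
size-split {suc n} f g = trans
  (cong₂ _+_ (size-split (f ↾ true) (g ↾ true)) (size-split (f ↾ false) (g ↾ false)))
  (+-swap₄ (size ((f ↾ true) ∩ᶠ (g ↾ true))) _ _ _)

size-shift : ∀ {n} i (f : Family (suc (suc n))) → size (shift i f) ≡ size f
size-shift zero f = lem (size (f ↾ true ↾ true)) _ _ _ _
  (size (f ↾ false ↾ false)) (size-∪∩ (f ↾ true ↾ false) (f ↾ false ↾ true))
  where
  regroup : ∀ a b c d → (a + b) + (c + d) ≡ a + (b + c) + d
  regroup = solve-∀
  lem : ∀ a b c b′ c′ d → b + c ≡ b′ + c′ → (a + b) + (c + d) ≡ (a + b′) + (c′ + d)
  lem a b c b′ c′ d e = trans (regroup a b c d)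
    (trans (cong (λ x → a + x + d) e) (sym (regroup a b′ c′ d)))
size-shift {suc n} (suc i) f = cong₂ _+_ (size-shift i (f ↾ true)) (size-shift i (f ↾ false))

moved : ∀ {n} → Fin (suc n) → Family (suc (suc n)) → ℕ
moved zero            f = size (compl (f ↾ true ↾ false) ∩ᶠ (f ↾ false ↾ true))
moved {suc n} (suc i) f = moved i (f ↾ true) + moved i (f ↾ false)

potential-shift : ∀ {n} i (f : Family (suc (suc n))) →
  potential f ≡ potential (shift i f) + moved i f
potential-shift {n} zero f = begin
  suc n * (sft + sff) + ((n * stf + (ptt + ptf)) + (n * sff + (pft + pff)))
    ≡⟨ lem₁ n sft sff stf ptt ptf pft pff ⟩
  sft + n * (stf + sft) + (ptf + pft) + c
    ≡⟨ cong₂ (λ x y → x + y + (ptf + pft) + c) (size-split tf ft) (cong (n *_) (sym (size-∪∩ tf ft))) ⟩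
  s∩ + e + n * (s∪ + s∩) + (ptf + pft) + c
    ≡⟨ cong (λ x → s∩ + e + n * (s∪ + s∩) + x + c) (potential-∪∩ tf ft) ⟨
  s∩ + e + n * (s∪ + s∩) + (p∪ + p∩) + c
    ≡⟨ lem₂ n s∩ e s∪ p∪ p∩ sff ptt pff ⟩
  suc n * (s∩ + sff) + ((n * s∪ + (ptt + p∪)) + (n * sff + (p∩ + pff))) + e ∎
  where
  open ≡-Reasoning
  tf = f ↾ true ↾ false
  ft = f ↾ false ↾ true
  sft = size ft
  stf = size tf
  sff = size (f ↾ false ↾ false)
  s∪ = size (tf ∪ᶠ ft)
  s∩ = size (tf ∩ᶠ ft)
  p∪ = potential (tf ∪ᶠ ft)
  p∩ = potential (tf ∩ᶠ ft)
  ptt = potential (f ↾ true ↾ true)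
  ptf = potential tf
  pft = potential ft
  pff = potential (f ↾ false ↾ false)
  e = moved zero f
  c = suc n * sff + n * sff + ptt + pff
  lem₁ : ∀ n sft sff stf ptt ptf pft pff →
    suc n * (sft + sff) + ((n * stf + (ptt + ptf)) + (n * sff + (pft + pff)))
    ≡ sft + n * (stf + sft) + (ptf + pft) + (suc n * sff + n * sff + ptt + pff)
  lem₁ = solve-∀
  lem₂ : ∀ n s∩ e s∪ p∪ p∩ sff ptt pff →
    s∩ + e + n * (s∪ + s∩) + (p∪ + p∩) + (suc n * sff + n * sff + ptt + pff)
    ≡ suc n * (s∩ + sff) + ((n * s∪ + (ptt + p∪)) + (n * sff + (p∩ + pff))) + e
  lem₂ = solve-∀
potential-shift {suc n} (suc i) f = begin
  suc (suc n) * size (f ↾ false) + (potential (f ↾ true) + potential (f ↾ false))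
    ≡⟨ cong₂ (λ x y → suc (suc n) * x + y) (sym (size-shift i (f ↾ false)))
         (cong₂ _+_ (potential-shift i (f ↾ true)) (potential-shift i (f ↾ false))) ⟩
  a + ((b + m₁) + (d + m₀))
    ≡⟨ lem a b m₁ d m₀ ⟩
  a + (b + d) + (m₁ + m₀) ∎
  where
  open ≡-Reasoning
  a = suc (suc n) * size (shift i (f ↾ false))
  b = potential (shift i (f ↾ true))
  d = potential (shift i (f ↾ false))
  m₁ = moved i (f ↾ true)
  m₀ = moved i (f ↾ false)
  lem : ∀ a b m d m′ → a + ((b + m) + (d + m′)) ≡ a + (b + d) + (m + m′)
  lem = solve-∀

size≡0 : ∀ {n} (f : Family n) → size f ≡ 0 → ∀ F → f F ≡ false
size≡0 {zero} f e [] with f []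
... | false = refl
size≡0 {suc n} f e (true ∷ F)  = size≡0 (f ↾ true) (m+n≡0⇒m≡0 _ e) F
size≡0 {suc n} f e (false ∷ F) = size≡0 (f ↾ false) (m+n≡0⇒n≡0 (size (f ↾ true)) e) F

unmoved⇒shifted : ∀ {n} (f : Family (suc (suc n))) → (∀ i → moved i f ≡ 0) → Shifted f
unmoved⇒shifted {n} f e = adjacent , rest n f e
  where
  adjacent : ∀ F → f ∋ false ∷ true ∷ F → f ∋ true ∷ false ∷ F
  adjacent F fF with f (true ∷ false ∷ F) | size≡0 _ (e zero) F
  ... | true  | _ = refl
  ... | false | q = trans (sym q) fF
  rest : ∀ n (f : Family (suc (suc n))) → (∀ i → moved i f ≡ 0) → ∀ b → Shifted (f ↾ b)
  rest zero f e b = Unit.tt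
  rest (suc n) f e true  = unmoved⇒shifted (f ↾ true) (λ i → m+n≡0⇒m≡0 _ (e (suc i)))
  rest (suc n) f e false = unmoved⇒shifted (f ↾ false)
    (λ i → m+n≡0⇒n≡0 (moved i (f ↾ true)) (e (suc i)))

Compressed : ∀ {n} → ℕ → ℕ → Family n → Set
Compressed {n} j c f =
  ∃ λ (g : Family n) → Shifted g × Cross j c g ⊤ × (∀ k → cnt k g ≡ cnt k f)

compress : ∀ {n} j c (f : Family n) → Cross j c f ⊤ → Compressed j c f
compress {zero}        j c f p = f , Unit.tt , p , λ _ → refl
compress {suc zero}    j c f p = f , Unit.tt , p , λ _ → refl
compress {suc (suc n)} j c f p = go (suc (potential f)) f p ≤-refl
  where
  -- `m` exceeds the potential, which drops by `moved i f` ≥ 1 with each shift performed.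
  go : ∀ m (f : Family (suc (suc n))) → Cross j c f ⊤ → potential f < m → Compressed j c f
  go (suc m) f p f<m with any? (λ i → 1 ≤? moved i f)
  ... | no  stable = f , unmoved⇒shifted f (λ i → n<1⇒n≡0 (≰⇒> (λ q → stable (i , q)))) , p , λ _ → refl
  ... | yes (i , q) with go m (shift i f) (cross-shift i j p)
        (≤-trans (subst (potential (shift i f) <_) (sym (potential-shift i f)) (m<m+n _ q)) (s≤s⁻¹ f<m))
  ...   | g , sh , cg , e = g , sh , cg , λ k → trans (e k) (cnt-shift i k f)

-- The Erdős–Ko–Rado theorem

infixl 8 _⇂_
-- In a shifted family an element at the last coordinate can be exchanged for any missing earlier
-- one; the Erdős-Ko-Rado induction therefore splits there.
_⇂_ : ∀ {n} → Family (suc n) → Bool → Family n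
(f ⇂ b) F = f (F ∷ʳ b)

cnt-⇂₀ : ∀ {n} (f : Family (suc n)) → cnt 0 f ≡ cnt 0 (f ⇂ false)
cnt-⇂₀ {zero}  f = refl
cnt-⇂₀ {suc n} f = cnt-⇂₀ (f ↾ false)

cnt-⇂ : ∀ {n} k (f : Family (suc n)) → cnt (suc k) f ≡ cnt k (f ⇂ true) + cnt (suc k) (f ⇂ false)
cnt-⇂ {zero} zero    f = refl
cnt-⇂ {zero} (suc k) f = refl
cnt-⇂ {suc n} zero f = begin
  cnt 0 (f ↾ true) + cnt 1 (f ↾ false)
    ≡⟨ cong₂ _+_ (cnt-⇂₀ (f ↾ true)) (cnt-⇂ 0 (f ↾ false)) ⟩
  cnt 0 (f ↾ true ⇂ false) + (cnt 0 (f ↾ false ⇂ true) + cnt 1 (f ↾ false ⇂ false))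
    ≡⟨ +-swap₃ (cnt 0 (f ↾ true ⇂ false)) (cnt 0 (f ↾ false ⇂ true)) (cnt 1 (f ↾ false ⇂ false)) ⟩
  cnt 0 (f ⇂ true) + cnt 1 (f ⇂ false) ∎
  where open ≡-Reasoning
cnt-⇂ {suc n} (suc k) f = begin
  cnt (suc k) (f ↾ true) + cnt (suc (suc k)) (f ↾ false)
    ≡⟨ cong₂ _+_ (cnt-⇂ k (f ↾ true)) (cnt-⇂ (suc k) (f ↾ false)) ⟩
  (cnt k (f ↾ true ⇂ true) + cnt (suc k) (f ↾ true ⇂ false))
    + (cnt (suc k) (f ↾ false ⇂ true) + cnt (suc (suc k)) (f ↾ false ⇂ false))
    ≡⟨ +-swap₄ (cnt k (f ↾ true ⇂ true)) _ _ _ ⟩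
  cnt (suc k) (f ⇂ true) + cnt (suc (suc k)) (f ⇂ false) ∎
  where open ≡-Reasoning

∣∷ʳtrue∣ : ∀ {n} (F : Subset n) → ∣ F ∷ʳ true ∣ ≡ suc ∣ F ∣
∣∷ʳtrue∣ []          = refl
∣∷ʳtrue∣ (true ∷ F)  = cong suc (∣∷ʳtrue∣ F)
∣∷ʳtrue∣ (false ∷ F) = ∣∷ʳtrue∣ F

∣∷ʳfalse∣ : ∀ {n} (F : Subset n) → ∣ F ∷ʳ false ∣ ≡ ∣ F ∣
∣∷ʳfalse∣ []          = refl
∣∷ʳfalse∣ (true ∷ F)  = cong suc (∣∷ʳfalse∣ F)
∣∷ʳfalse∣ (false ∷ F) = ∣∷ʳfalse∣ F

∷ʳ-∩ : ∀ {n} (F G : Subset n) {a b} → (F ∷ʳ a) ∩ (G ∷ʳ b) ≡ (F ∩ G) ∷ʳ (a ∧ b)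
∷ʳ-∩ []      []      = refl
∷ʳ-∩ (x ∷ F) (y ∷ G) = cong (x ∧ y ∷_) (∷ʳ-∩ F G)

shifted-⇂ : ∀ {n} {f : Family (suc n)} → Shifted f → ∀ b → Shifted (f ⇂ b)
shifted-⇂ {zero}        sh b = Unit.tt
shifted-⇂ {suc zero}    sh b = Unit.tt
shifted-⇂ {suc (suc n)} {f} (s , sb) b = (λ F → s (F ∷ʳ b)) , λ c → shifted-⇂ {f = f ↾ c} (sb c) b

remove-last : ∀ {n} (X : Subset n) → Remove (X ∷ʳ true) (X ∷ʳ false)
remove-last []      = here
remove-last (x ∷ X) = there (remove-last X)

shifted-last : ∀ {n} {f : Family (suc n)} → Shifted f →
  ∀ {X Y} → Remove Y X → f ∋ X ∷ʳ true → f ∋ Y ∷ʳ false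
shifted-last {suc n} {f} sh (here {X = X}) fX = shifted-remove {f = f} sh (remove-last X) fX
shifted-last {suc n} {f} sh (there {b = b} r) fX = shifted-last {f = f ↾ b} (shifted-↾ {f = f} sh b) r fX

common-gap : ∀ {n} (F G : Subset n) → ∣ F ∣ + ∣ G ∣ < n →
  ∃ λ Y → Remove Y F × Y ∩ G ≡ F ∩ G
common-gap (false ∷ F) (false ∷ G) p = true ∷ F , here , refl
common-gap (true ∷ F) (false ∷ G) p with common-gap F G (s≤s⁻¹ p)
... | Y , r , e = true ∷ Y , there r , cong (false ∷_) e
common-gap {suc n} (false ∷ F) (true ∷ G) p
  with common-gap F G (s≤s⁻¹ (subst (_< suc n) (+-suc ∣ F ∣ ∣ G ∣) p))
... | Y , r , e = false ∷ Y , there r , cong (false ∷_) e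
common-gap {suc n} (true ∷ F) (true ∷ G) p
  with common-gap F G (<-trans (n<1+n _) (s≤s⁻¹ (subst (λ x → suc x < suc n) (+-suc ∣ F ∣ ∣ G ∣) p)))
... | Y , r , e = true ∷ Y , there r , cong (true ∷_) e

Intersecting : ∀ {n} → ℕ → Family n → Set
Intersecting k f = ∀ F G → ∣ F ∣ ≡ k → ∣ G ∣ ≡ k → f ∋ F → f ∋ G → 1 ≤ ∣ F ∩ G ∣

intersecting-⇂false : ∀ {n k} {f : Family (suc n)} → Intersecting k f → Intersecting k (f ⇂ false)
intersecting-⇂false int F G eF eG fF fG = subst (1 ≤_)
  (trans (cong ∣_∣ (∷ʳ-∩ F G)) (∣∷ʳfalse∣ (F ∩ G)))
  (int _ _ (trans (∣∷ʳfalse∣ F) eF) (trans (∣∷ʳfalse∣ G) eG) fF fG)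

-- The sizes leave an element outside both `F` and `G`. Shiftedness lets it replace the last element
-- of the first set, and then all common elements of the two members lie in F ∩ G.
intersecting-⇂true : ∀ {n k} {f : Family (suc n)} → Shifted f → k + k < n →
  Intersecting (suc k) f → Intersecting k (f ⇂ true)
intersecting-⇂true {n} {f = f} sh k+k<n int F G refl eG fF fG
  with common-gap F G (subst (λ x → ∣ F ∣ + x < n) (sym eG) k+k<n)
... | Y , r , e = subst (1 ≤_)
  (trans (cong ∣_∣ (trans (∷ʳ-∩ Y G) (cong (_∷ʳ false) e))) (∣∷ʳfalse∣ (F ∩ G)))
  (int (Y ∷ʳ false) (G ∷ʳ true) (trans (∣∷ʳfalse∣ Y) (∣remove∣ r))
    (trans (∣∷ʳtrue∣ G) (cong suc eG)) (shifted-last {f = f} sh r fF) fG)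

intersecting-half : ∀ {n} k (f : Family n) → k + k ≤ n → Intersecting k f →
  cnt k f ≤ cnt k (compl f)
intersecting-half {n} k f k+k≤n int =
  *-cancelʳ-≤ _ _ (n C k) {{>-nonZero (C-pos (m+n≤o⇒m≤o k k+k≤n))}}
    (cnt-cross-intersecting k k f f k+k≤n int)

intersecting-0 : ∀ {n} (f : Family n) → Intersecting 0 f → cnt 0 f ≡ 0
intersecting-0 f int with cnt 0 f | cnt 0 (compl f) | cnt-compl 0 f | intersecting-half 0 f z≤n int
... | zero  | _ | _  | _ = refl
... | suc a | b | e  | s≤s {n = b′} a≤b with () ← trans (sym (+-suc a b′)) (suc-injective e)

2C : ∀ k → suc (k + suc k) C suc k ≡ 2 * ((k + suc k) C k)
2C k = begin
  suc (k + suc k) C suc k                  ≡⟨ nCk+nC[k+1]≡[n+1]C[k+1] (k + suc k) k ⟨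
  (k + suc k) C k + (k + suc k) C suc k    ≡⟨ cong ((k + suc k) C k +_)
    (trans (nCk≡nC[n∸k] (m≤n+m (suc k) k)) (cong ((k + suc k) C_) (m+n∸n≡m k (suc k)))) ⟩
  (k + suc k) C k + (k + suc k) C k        ≡⟨ cong ((k + suc k) C k +_) (+-identityʳ _) ⟨
  2 * ((k + suc k) C k)                    ∎
  where open ≡-Reasoning

-- Induction on the ground set. At n + 1 = 2 (k + 1) at most half of all sets belong to `f`, by
-- double counting against its complement. Beyond that, both restrictions at the last coordinate are
-- shifted and intersecting, and their bounds add up by Pascal's rule.
erdős-ko-rado : ∀ n k (f : Family (suc n)) → suc k + suc k ≤ suc n → Shifted f →
  Intersecting (suc k) f → cnt (suc k) f ≤ n C k
erdős-ko-rado n k f le sh int with suc k + suc k ≤? n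
erdős-ko-rado n k f le sh int | no  gt with ≤-antisym (s≤s⁻¹ le) (s≤s⁻¹ (≰⇒> gt))
... | refl = *-cancelˡ-≤ 2 (begin
  2 * cnt (suc k) f                           ≡⟨ cong (cnt (suc k) f +_) (+-identityʳ _) ⟩
  cnt (suc k) f + cnt (suc k) f               ≤⟨ +-monoʳ-≤ (cnt (suc k) f)
                                                   (intersecting-half (suc k) f le int) ⟩
  cnt (suc k) f + cnt (suc k) (compl f)       ≡⟨ cnt-compl (suc k) f ⟩
  suc (k + suc k) C suc k                     ≡⟨ 2C k ⟩
  2 * ((k + suc k) C k)                       ∎)
  where open ≤-Reasoning
erdős-ko-rado (suc n) k f le sh int | yes le′ = begin
  cnt (suc k) f                                  ≡⟨ cnt-⇂ k f ⟩
  cnt k (f ⇂ true) + cnt (suc k) (f ⇂ false)     ≤⟨ +-mono-≤ (link k le′ int)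
    (erdős-ko-rado n k (f ⇂ false) le′ (shifted-⇂ {f = f} sh false) (intersecting-⇂false {f = f} int)) ⟩
  pred-C k + n C k                               ≡⟨ pascal k ⟩
  suc n C k                                      ∎
  where
  open ≤-Reasoning
  -- C(n, k - 1), with value 0 at k = 0 to keep Pascal's rule true there.
  pred-C : ℕ → ℕ
  pred-C zero    = 0
  pred-C (suc k) = n C k
  pascal : ∀ k → pred-C k + n C k ≡ suc n C k
  pascal zero    = refl
  pascal (suc k) = nCk+nC[k+1]≡[n+1]C[k+1] n k
  smaller : ∀ k → suc k + suc k ≤ suc n → k + k < suc n
  smaller k le = ≤-trans (s≤s (+-monoʳ-≤ k (n≤1+n k))) le
  link : ∀ k → suc k + suc k ≤ suc n → Intersecting (suc k) f → cnt k (f ⇂ true) ≤ pred-C k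
  link zero    le int = ≤-reflexive
    (intersecting-0 (f ⇂ true) (intersecting-⇂true {f = f} sh (smaller 0 le) int))
  link (suc k) le int = erdős-ko-rado n k (f ⇂ true) (<⇒≤ (smaller (suc k) le))
    (shifted-⇂ {f = f} sh true) (intersecting-⇂true {f = f} sh (smaller (suc k) le) int)

-- Binomial ratios

C-absorb : ∀ n k → suc k * (suc n C suc k) ≡ suc n * (n C k)
C-absorb zero zero = refl
C-absorb zero (suc k) =
  trans (cong (suc (suc k) *_) (k>n⇒nCk≡0 {1} {suc (suc k)} (s≤s (s≤s z≤n))))
    (trans (*-zeroʳ (suc (suc k))) (sym (cong (1 *_) (k>n⇒nCk≡0 {0} {suc k} (s≤s z≤n)))))
C-absorb (suc n) zero = begin
  1 * (suc (suc n) C 1)               ≡⟨ cong (1 *_) (nCk+nC[k+1]≡[n+1]C[k+1] (suc n) 0) ⟨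
  1 * (1 + suc n C 1)                 ≡⟨ *-distribˡ-+ 1 1 (suc n C 1) ⟩
  1 + 1 * (suc n C 1)                 ≡⟨ cong (1 +_) (C-absorb n 0) ⟩
  suc (suc n) * 1                     ∎
  where open ≡-Reasoning
C-absorb (suc n) (suc k) = begin
  suc (suc k) * (suc (suc n) C suc (suc k))
    ≡⟨ cong (suc (suc k) *_) (nCk+nC[k+1]≡[n+1]C[k+1] (suc n) (suc k)) ⟨
  suc (suc k) * (x + y)
    ≡⟨ lem (suc k) x y ⟩
  x + suc k * x + suc (suc k) * y
    ≡⟨ cong₂ (λ u v → x + u + v) (C-absorb n k) (C-absorb n (suc k)) ⟩
  x + suc n * (n C k) + suc n * (n C suc k)
    ≡⟨ trans (+-assoc x _ _) (cong (x +_) (sym (*-distribˡ-+ (suc n) (n C k) (n C suc k)))) ⟩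
  x + suc n * (n C k + n C suc k)
    ≡⟨ cong (λ u → x + suc n * u) (nCk+nC[k+1]≡[n+1]C[k+1] n k) ⟩
  suc (suc n) * x ∎
  where
  open ≡-Reasoning
  x = suc n C suc k
  y = suc n C suc (suc k)
  lem : ∀ k x y → suc k * (x + y) ≡ x + k * x + suc k * y
  lem = solve-∀

C-absorb-+ : ∀ m l → suc l * (suc (m + l) C suc l) ≡ suc (m + l) * ((m + l) C l)
C-absorb-+ m l = C-absorb (m + l) l

C-sym-+ : ∀ m l → (m + l) C l ≡ (m + l) C m
C-sym-+ m l = trans (nCk≡nC[n∸k] (m≤n+m l m)) (cong ((m + l) C_) (m+n∸n≡m m l))

C-absorb-complement : ∀ m l → suc m * (suc (m + l) C l) ≡ suc (m + l) * ((m + l) C l)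
C-absorb-complement m l = begin
  suc m * (suc (m + l) C l)        ≡⟨ cong (suc m *_) (C-sym-+ (suc m) l) ⟩
  suc m * (suc (m + l) C suc m)    ≡⟨ C-absorb (m + l) m ⟩
  suc (m + l) * ((m + l) C m)      ≡⟨ cong (suc (m + l) *_) (C-sym-+ m l) ⟨
  suc (m + l) * ((m + l) C l)      ∎
  where open ≡-Reasoning

-- With L = l + 2 and M = m + L + 1, absorption gives the quotient L (L - 1) / ((M - 1) (M - 2)).
-- Its first factor L / (M - 1) exceeds L / M; 2 L ≤ m + 1 makes the second small enough for the
-- product to be at most (L / M)².
ratio-2 : ∀ m l → 2 * (2 + l) ≤ suc m →
  ((m + l) C l) * (suc (m + (2 + l)) ^ 2) ≤ ((m + (2 + l)) C (2 + l)) * ((2 + l) ^ 2)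
ratio-2 m l le = *-cancelʳ-≤ _ _ (suc (m + l) * suc (suc (m + l))) (begin
  c₀ * M ^ 2 * (x * y)              ≡⟨ lem₁ c₀ (M ^ 2) x y ⟩
  M ^ 2 * (y * (x * c₀))            ≡⟨ cong (λ z → M ^ 2 * (y * z)) (C-absorb-+ m l) ⟨
  M ^ 2 * (y * (suc l * c₁))        ≡⟨ lem₂ (M ^ 2) y (suc l) c₁ ⟩
  M ^ 2 * suc l * (y * c₁)          ≡⟨ cong (M ^ 2 * suc l *_) (C-absorb (suc (m + l)) (suc l)) ⟨
  M ^ 2 * suc l * ((2 + l) * c₂′)   ≡⟨ lem₃ (M ^ 2) (suc l) (2 + l) c₂′ ⟩
  suc l * M ^ 2 * ((2 + l) * c₂′)   ≤⟨ *-monoˡ-≤ ((2 + l) * c₂′) poly ⟩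
  (2 + l) * (x * y) * ((2 + l) * c₂′) ≡⟨ lem₄ (2 + l) (x * y) c₂′ ⟩
  c₂′ * (2 + l) ^ 2 * (x * y)       ≡⟨ cong (λ z → (z C (2 + l)) * (2 + l) ^ 2 * (x * y)) (shape m l) ⟨
  ((m + (2 + l)) C (2 + l)) * (2 + l) ^ 2 * (x * y) ∎)
  where
  open ≤-Reasoning
  M = suc (m + (2 + l))
  x = suc (m + l)
  y = suc (suc (m + l))
  c₀ = (m + l) C l
  c₁ = suc (m + l) C suc l
  c₂′ = suc (suc (m + l)) C suc (suc l)
  shape : ∀ m l → m + (2 + l) ≡ suc (suc (m + l))
  shape = solve-∀
  lem₁ : ∀ c M x y → c * M * (x * y) ≡ M * (y * (x * c))
  lem₁ = solve-∀
  lem₂ : ∀ M y s c → M * (y * (s * c)) ≡ M * s * (y * c)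
  lem₂ = solve-∀
  lem₃ : ∀ M s t c → M * s * (t * c) ≡ s * M * (t * c)
  lem₃ = solve-∀
  lem₄ : ∀ t z c → t * z * (t * c) ≡ c * (t * (t * 1)) * z
  lem₄ = solve-∀
  -- `d` is the slack in the hypothesis on `m`; after the substitution the difference of the two
  -- sides has no negative coefficient.
  expand : ∀ l d → let m = 3 + (l + l) + d ; M = suc (m + (2 + l)) in
    (2 + l) * (suc (m + l) * suc (suc (m + l)))
    ≡ suc l * (M * (M * 1)) + (M * d + 2 * (2 + l))
  expand = solve-∀
  poly : suc l * M ^ 2 ≤ (2 + l) * (x * y)
  poly with m ∸ (3 + (l + l)) | m+[n∸m]≡n (s≤s⁻¹ (subst (_≤ suc m) (shape₂ l) le))
    where
    shape₂ : ∀ l → 2 * (2 + l) ≡ suc (3 + (l + l))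
    shape₂ = solve-∀
  ... | d | refl = ≤-trans (m≤m+n _ _) (≤-reflexive (sym (expand l d)))

ratio-3 : ∀ m l → 3 + l ≤ suc m →
  ((m + l) C l) * (suc (m + (3 + l)) ^ 3) ≤ ((m + (3 + l)) C (3 + l)) * ((3 + l) ^ 3)
ratio-3 m l le = *-cancelʳ-≤ _ _ (x * y * z) (begin
  c₀ * M ^ 3 * (x * y * z)                  ≡⟨ lem₁ c₀ (M ^ 3) x y z ⟩
  M ^ 3 * y * z * (x * c₀)                  ≡⟨ cong (M ^ 3 * y * z *_) (C-absorb-+ m l) ⟨
  M ^ 3 * y * z * (suc l * c₁)              ≡⟨ lem₂ (M ^ 3) y z (suc l) c₁ ⟩
  M ^ 3 * z * suc l * (y * c₁)              ≡⟨ cong (M ^ 3 * z * suc l *_) (C-absorb (suc (m + l)) (suc l)) ⟨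
  M ^ 3 * z * suc l * ((2 + l) * c₂)        ≡⟨ lem₃ (M ^ 3) z (suc l) (2 + l) c₂ ⟩
  M ^ 3 * suc l * (2 + l) * (z * c₂)        ≡⟨ cong (M ^ 3 * suc l * (2 + l) *_)
                                                 (C-absorb (2 + (m + l)) (2 + l)) ⟨
  M ^ 3 * suc l * (2 + l) * ((3 + l) * c₃)  ≡⟨ lem₄ (M ^ 3) (suc l) (2 + l) ((3 + l) * c₃) ⟩
  suc l * (2 + l) * M ^ 3 * ((3 + l) * c₃)  ≤⟨ *-monoˡ-≤ ((3 + l) * c₃) poly ⟩
  (3 + l) * (3 + l) * (x * y * z) * ((3 + l) * c₃) ≡⟨ lem₅ (3 + l) (x * y * z) c₃ ⟩
  c₃ * (3 + l) ^ 3 * (x * y * z)            ≡⟨ cong (λ u → (u C (3 + l)) * (3 + l) ^ 3 * (x * y * z)) (shape m l) ⟨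
  ((m + (3 + l)) C (3 + l)) * (3 + l) ^ 3 * (x * y * z) ∎)
  where
  open ≤-Reasoning
  M = suc (m + (3 + l))
  x = suc (m + l)
  y = 2 + (m + l)
  z = 3 + (m + l)
  c₀ = (m + l) C l
  c₁ = suc (m + l) C suc l
  c₂ = (2 + (m + l)) C (2 + l)
  c₃ = (3 + (m + l)) C (3 + l)
  shape : ∀ m l → m + (3 + l) ≡ 3 + (m + l)
  shape = solve-∀
  lem₁ : ∀ c M x y z → c * M * (x * y * z) ≡ M * y * z * (x * c)
  lem₁ = solve-∀
  lem₂ : ∀ M y z s c → M * y * z * (s * c) ≡ M * z * s * (y * c)
  lem₂ = solve-∀
  lem₃ : ∀ M z s t c → M * z * s * (t * c) ≡ M * s * t * (z * c)
  lem₃ = solve-∀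
  lem₄ : ∀ M s t c → M * s * t * c ≡ s * t * M * c
  lem₄ = solve-∀
  lem₅ : ∀ t z c → t * t * z * (t * c) ≡ c * (t * (t * (t * 1))) * z
  lem₅ = solve-∀
  expand : ∀ l d → let m = 2 + l + d ; M = suc (m + (3 + l)) in
    (3 + l) * (3 + l) * (suc (m + l) * (2 + (m + l)) * (3 + (m + l)))
    ≡ suc l * (2 + l) * (M * (M * (M * 1)))
      + (108 + 207 * d + 72 * (d * d) + 7 * (d * d * d)
        + l * (126 + 246 * d + 60 * (d * d) + 3 * (d * d * d))
        + l * l * (48 + 95 * d + 12 * (d * d))
        + l * l * l * (6 + 12 * d))
  expand = solve-∀
  poly : suc l * (2 + l) * M ^ 3 ≤ (3 + l) * (3 + l) * (x * y * z)
  poly with m ∸ (2 + l) | m+[n∸m]≡n (s≤s⁻¹ le)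
  ... | d | refl = ≤-trans (m≤m+n _ _) (≤-reflexive (sym (expand l d)))

-- For j = 2 a single later factor has to offset the first one in `ratio`, hence the stronger
-- demand; from j = 3 on, l ≤ m suffices.
Wide : ℕ → ℕ → ℕ → Set
Wide j l m = l ≤ m × (j ≡ 2 → 2 * l ≤ m)

-- The factor (l - i) / (M - 1 - i) is at most l / M for i ≥ 1 only; in ratio-2 and ratio-3
-- the later factors make up for the first one.
ratio-step : ∀ j m l → suc j + l ≤ suc m →
  ((m + suc l) C suc l) * (suc (m + (j + suc l)) ^ j) ≤ ((m + (j + suc l)) C (j + suc l)) * ((j + suc l) ^ j) →
  1 ≤ j →
  ((m + l) C l) * (suc (m + (suc j + l)) ^ suc j) ≤ ((m + (suc j + l)) C (suc j + l)) * ((suc j + l) ^ suc j)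
ratio-step j m l le ih 1≤j = subst
  (λ L → ((m + l) C l) * (suc (m + L) ^ suc j) ≤ ((m + L) C L) * (L ^ suc j))
  (+-suc j l) (*-cancelʳ-≤ _ _ (suc (m + l)) (begin
  c₀ * (M * p) * suc (m + l)          ≡⟨ lem₁ c₀ M p (suc (m + l)) ⟩
  M * p * (suc (m + l) * c₀)          ≡⟨ cong (M * p *_) (C-absorb-+ m l) ⟨
  M * p * (suc l * c₁)                ≡⟨ lem₂ M p (suc l) c₁ ⟩
  suc l * M * (c₁ * p)                ≡⟨ cong (λ u → suc l * M * ((u C suc l) * p)) (+-suc m l) ⟨
  suc l * M * (((m + suc l) C suc l) * p) ≤⟨ *-mono-≤ small ih ⟩
  L * suc (m + l) * (c * L ^ j)       ≡⟨ lem₃ L (suc (m + l)) c (L ^ j) ⟩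
  c * (L * L ^ j) * suc (m + l)       ∎))
  where
  open ≤-Reasoning
  L = j + suc l
  M = suc (m + L)
  p = M ^ j
  c₀ = (m + l) C l
  c₁ = suc (m + l) C suc l
  c = (m + L) C L
  lem₁ : ∀ c M p x → c * (M * p) * x ≡ M * p * (x * c)
  lem₁ = solve-∀
  lem₂ : ∀ M p s c → M * p * (s * c) ≡ s * M * (c * p)
  lem₂ = solve-∀
  lem₃ : ∀ L x c q → L * x * (c * q) ≡ c * (L * q) * x
  lem₃ = solve-∀
  lem₄ : ∀ j m l → suc l * suc (m + (j + suc l)) ≡ suc l * (m + suc l) + suc l * j + suc l
  lem₄ = solve-∀
  lem₅ : ∀ j m l → (j + suc l) * suc (m + l) ≡ suc l * (m + suc l) + suc l * j + j * m
  lem₅ = solve-∀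
  l<m : suc l ≤ m
  l<m = s≤s⁻¹ (≤-trans (+-monoˡ-≤ (suc l) 1≤j) (subst (_≤ suc m) (sym (+-suc j l)) le))
  small : suc l * M ≤ L * suc (m + l)
  small = subst₂ _≤_ (sym (lem₄ j m l)) (sym (lem₅ j m l))
    (+-monoʳ-≤ (suc l * (m + suc l) + suc l * j)
      (≤-trans l<m (subst (_≤ j * m) (*-identityˡ m) (*-monoˡ-≤ m 1≤j))))

ratio : ∀ j m l → 2 ≤ j → Wide j (j + l) (suc m) →
  ((m + l) C l) * (suc (m + (j + l)) ^ j) ≤ ((m + (j + l)) C (j + l)) * ((j + l) ^ j)
ratio (suc zero) m l (s≤s ())
ratio 2 m l _ (_ , w) = ratio-2 m l (w refl)
ratio 3 m l _ (w , _) = ratio-3 m l w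
ratio (suc (suc (suc (suc j)))) m l _ (w , _) = ratio-step (3 + j) m l w
  (ratio (suc (suc (suc j))) m (suc l) (s≤s (s≤s z≤n)) (subst (_≤ suc m) (sym (+-suc (3 + j) l)) w , λ ()))
  (s≤s z≤n)

-- Estimates for words that reach level 0

hit-few : ∀ j n t u → u < t → hit j n t u ≡ 0
hit-few j zero    (suc t) u       _       = refl
hit-few j (suc n) (suc t) zero    _       = hit-few j n (suc (j + t)) zero z<s
hit-few j (suc n) (suc t) (suc u) (s≤s q) = cong₂ _+_ (hit-few j n t u q)
  (hit-few j n (suc (j + t)) (suc u) (s≤s (≤-trans q (m≤n+m t j))))

hit≤C : ∀ j n t u → hit j n t u ≤ n C u
hit≤C j n t u = ≤-trans (m≤m+n _ _) (≤-reflexive (hit+nonhit j n t u))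

^-distribʳ-* : ∀ x y k → (x * y) ^ k ≡ x ^ k * y ^ k
^-distribʳ-* x y zero    = refl
^-distribʳ-* x y (suc k) = trans (cong (x * y *_) (^-distribʳ-* x y k)) (lem x y (x ^ k) (y ^ k))
  where
  lem : ∀ a b c d → a * b * (c * d) ≡ a * c * (b * d)
  lem = solve-∀

-- In the application A / B is a t / b, so Q / A is the base β; powers of `A` clear denominators.
-- The assumption `BQ≤A²` says (B / A) β ≤ 1 and serves the second case of `dichotomy`.
module Decay (j A B : ℕ) (2≤j : 2 ≤ j) (1≤B : 1 ≤ B) (B≤A : B ≤ A)
  (BQ≤A² : B * (A + B) ≤ A * A) where

  private
    Q r : ℕ
    Q = A + B
    r = suc j

    1≤j : 1 ≤ j
    1≤j = ≤-trans (s≤s z≤n) 2≤j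

    instance
      A≢0 : NonZero A
      A≢0 = >-nonZero (≤-trans 1≤B B≤A)
      B≢0 : NonZero B
      B≢0 = >-nonZero 1≤B

  Small : ℕ → ℕ → Set
  Small l m = A * l ^ j ≤ B * m ^ j × Wide j l m

  -- Spending one zero and the `j` ones that undo it cannot increase the quotient: l / m ≤ (j + l) /
  -- (m + 1), because l ≤ m ≤ j m.
  small-down : ∀ l m → Small (j + l) (suc m) → Small l m
  small-down l m (p , w , w₂) = *-cancelʳ-≤ _ _ (suc m ^ j) {{m^n≢0 (suc m) j}} (begin
      A * l ^ j * suc m ^ j          ≡⟨ *-assoc A _ _ ⟩
      A * (l ^ j * suc m ^ j)        ≡⟨ cong (A *_) (^-distribʳ-* l (suc m) j) ⟨
      A * (l * suc m) ^ j            ≤⟨ *-monoʳ-≤ A (^-monoˡ-≤ j steps) ⟩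
      A * ((j + l) * m) ^ j          ≡⟨ cong (A *_) (^-distribʳ-* (j + l) m j) ⟩
      A * ((j + l) ^ j * m ^ j)      ≡⟨ *-assoc A _ _ ⟨
      A * (j + l) ^ j * m ^ j        ≤⟨ *-monoˡ-≤ (m ^ j) p ⟩
      B * suc m ^ j * m ^ j          ≡⟨ lem B (suc m ^ j) (m ^ j) ⟩
      B * m ^ j * suc m ^ j          ∎)
    , l≤m , narrow
    where
    open ≤-Reasoning
    lem : ∀ a b c → a * b * c ≡ a * c * b
    lem = solve-∀
    l≤m : l ≤ m
    l≤m = s≤s⁻¹ (≤-trans (+-monoˡ-≤ l 1≤j) w)
    lem₂ : ∀ l → 2 * (1 + l) ≡ suc (suc (2 * l))
    lem₂ = solve-∀
    narrow : j ≡ 2 → 2 * l ≤ m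
    narrow e = ≤-trans (n≤1+n _) (s≤s⁻¹ (subst (_≤ suc m) (lem₂ l)
      (≤-trans (*-monoʳ-≤ 2 (+-monoˡ-≤ l 1≤j)) (w₂ e))))
    steps : l * suc m ≤ (j + l) * m
    steps = subst₂ _≤_ (sym (*-suc l m)) (sym (*-distribʳ-+ m j l))
      (+-monoˡ-≤ (l * m) (≤-trans l≤m (subst (_≤ j * m) (*-identityˡ m) (*-monoˡ-≤ m 1≤j))))

  B^≤A^ : ∀ k → B ^ k ≤ A ^ k
  B^≤A^ k = ^-monoˡ-≤ k B≤A

  -- With x = l / m and b = B / A: either b ≤ x, so that (1 + b) m ≤ m + l, or
  -- x < b, so that (1 + b) l ≤ b (m + l).
  dichotomy : ∀ l m → A * l ^ j ≤ B * m ^ j →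
    A * Q ^ j * l ^ j ≤ B * A ^ j * (m + l) ^ j ×
    A * Q ^ r * (l ^ j * m) ≤ B * A ^ r * (m + l) ^ r
  dichotomy l m p with ≤-total (B * m) (A * l)
  ... | inj₁ le = first , second
    where
    open ≤-Reasoning
    M = m + l
    Qm≤AM : Q * m ≤ A * M
    Qm≤AM = subst₂ _≤_ (sym (*-distribʳ-+ m A B)) (sym (*-distribˡ-+ A m l)) (+-monoʳ-≤ (A * m) le)
    lem₁ : ∀ a q x → a * q * x ≡ q * (a * x)
    lem₁ = solve-∀
    lem₂ : ∀ b q x → q * (b * x) ≡ b * (q * x)
    lem₂ = solve-∀
    first : A * Q ^ j * l ^ j ≤ B * A ^ j * M ^ j
    first = begin
      A * Q ^ j * l ^ j         ≡⟨ lem₁ A (Q ^ j) (l ^ j) ⟩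
      Q ^ j * (A * l ^ j)       ≤⟨ *-monoʳ-≤ (Q ^ j) p ⟩
      Q ^ j * (B * m ^ j)       ≡⟨ lem₂ B (Q ^ j) (m ^ j) ⟩
      B * (Q ^ j * m ^ j)       ≡⟨ cong (B *_) (^-distribʳ-* Q m j) ⟨
      B * (Q * m) ^ j           ≤⟨ *-monoʳ-≤ B (^-monoˡ-≤ j Qm≤AM) ⟩
      B * (A * M) ^ j           ≡⟨ cong (B *_) (^-distribʳ-* A M j) ⟩
      B * (A ^ j * M ^ j)       ≡⟨ *-assoc B _ _ ⟨
      B * A ^ j * M ^ j         ∎
    lem₃ : ∀ a q qj x m → a * (q * qj) * (x * m) ≡ a * qj * x * (q * m)
    lem₃ = solve-∀
    lem₄ : ∀ b aj mj a m → b * aj * mj * (a * m) ≡ b * (a * aj) * (m * mj)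
    lem₄ = solve-∀
    second : A * Q ^ r * (l ^ j * m) ≤ B * A ^ r * M ^ r
    second = begin
      A * (Q * Q ^ j) * (l ^ j * m)     ≡⟨ lem₃ A Q (Q ^ j) (l ^ j) m ⟩
      A * Q ^ j * l ^ j * (Q * m)       ≤⟨ *-mono-≤ first Qm≤AM ⟩
      B * A ^ j * M ^ j * (A * M)       ≡⟨ lem₄ B (A ^ j) (M ^ j) A M ⟩
      B * (A * A ^ j) * (M * M ^ j)     ∎
  ... | inj₂ ge = first , second
    where
    open ≤-Reasoning
    M = m + l
    Ql≤BM : Q * l ≤ B * M
    Ql≤BM = subst₂ _≤_ (sym (*-distribʳ-+ l A B)) (sym (*-distribˡ-+ B m l)) (+-monoˡ-≤ (B * l) ge)
    QlM : Q ^ j * l ^ j ≤ B ^ j * M ^ j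
    QlM = subst₂ _≤_ (^-distribʳ-* Q l j) (^-distribʳ-* B M j) (^-monoˡ-≤ j Ql≤BM)
    AB^≤BA^ : ∀ k → 1 ≤ k → A * B ^ k ≤ B * A ^ k
    AB^≤BA^ (suc k) _ = subst (_≤ B * (A * A ^ k)) (lem A B (B ^ k))
      (*-monoʳ-≤ B (*-monoʳ-≤ A (B^≤A^ k)))
      where
      lem : ∀ a b x → b * (a * x) ≡ a * (b * x)
      lem = solve-∀
    first : A * Q ^ j * l ^ j ≤ B * A ^ j * M ^ j
    first = begin
      A * Q ^ j * l ^ j         ≡⟨ *-assoc A _ _ ⟩
      A * (Q ^ j * l ^ j)       ≤⟨ *-monoʳ-≤ A QlM ⟩
      A * (B ^ j * M ^ j)       ≡⟨ *-assoc A _ _ ⟨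
      A * B ^ j * M ^ j         ≤⟨ *-monoˡ-≤ (M ^ j) (AB^≤BA^ j 1≤j) ⟩
      B * A ^ j * M ^ j         ∎
    QAB : ∀ k → 2 ≤ k → A * B ^ k * Q ≤ B * (A * A ^ k)
    QAB (suc zero) (s≤s ())
    QAB (suc (suc k)) _ = begin
      A * (B * (B * B ^ k)) * Q     ≡⟨ lem A B (B ^ k) Q ⟩
      B * (A * (B * Q * B ^ k))     ≤⟨ *-monoʳ-≤ B (*-monoʳ-≤ A (*-mono-≤ BQ≤A² (B^≤A^ k))) ⟩
      B * (A * (A * A * A ^ k))     ≡⟨ cong (λ x → B * (A * x)) (*-assoc A A _) ⟩
      B * (A * (A * (A * A ^ k)))   ∎
      where
      lem : ∀ a b x q → a * (b * (b * x)) * q ≡ b * (a * (b * q * x))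
      lem = solve-∀
    lem₃ : ∀ a q qj x m → a * (q * qj) * (x * m) ≡ a * (qj * x) * (q * m)
    lem₃ = solve-∀
    lem₄ : ∀ a bj mj q m → a * (bj * mj) * (q * m) ≡ a * bj * q * (m * mj)
    lem₄ = solve-∀
    second : A * Q ^ r * (l ^ j * m) ≤ B * A ^ r * M ^ r
    second = begin
      A * (Q * Q ^ j) * (l ^ j * m)     ≡⟨ lem₃ A Q (Q ^ j) (l ^ j) m ⟩
      A * (Q ^ j * l ^ j) * (Q * m)     ≤⟨ *-mono-≤ (*-monoʳ-≤ A QlM) (*-monoʳ-≤ Q (m≤m+n m l)) ⟩
      A * (B ^ j * M ^ j) * (Q * M)     ≡⟨ lem₄ A (B ^ j) (M ^ j) Q M ⟩
      A * B ^ j * Q * (M * M ^ j)       ≤⟨ *-monoˡ-≤ (M * M ^ j) (QAB j 2≤j) ⟩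
      B * (A * A ^ j) * (M * M ^ j)     ∎

  -- `ratio` supplies (L / M)^j, absorption supplies (m + 1) / M, and the second half of `dichotomy`
  -- bounds their product. After division by A^r: β^r C(m + l, l) ≤ (B / A) C(m + 1 + L, L).
  C-decay : ∀ l m → Small (j + l) (suc m) →
    Q ^ r * ((m + l) C l) ≤ B * A ^ j * (suc (m + (j + l)) C (j + l))
  C-decay l m (p , w) = *-cancelʳ-≤ _ _ (A * M ^ r) {{m*n≢0 A (M ^ r) {{A≢0}} {{m^n≢0 M r}}}} (begin
    Q ^ r * c₀ * (A * (M * M ^ j))            ≡⟨ lem₁ (Q ^ r) c₀ A M (M ^ j) ⟩
    A * Q ^ r * M * (c₀ * M ^ j)              ≤⟨ *-monoʳ-≤ (A * Q ^ r * M) (ratio j m l 2≤j w) ⟩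
    A * Q ^ r * M * (c₁ * L ^ j)              ≡⟨ lem₂ (A * Q ^ r) M c₁ (L ^ j) ⟩
    A * Q ^ r * L ^ j * (M * c₁)              ≡⟨ cong (A * Q ^ r * L ^ j *_) (C-absorb-complement m L) ⟨
    A * Q ^ r * L ^ j * (suc m * c)           ≡⟨ lem₃ (A * Q ^ r) (L ^ j) (suc m) c ⟩
    A * Q ^ r * (L ^ j * suc m) * c           ≤⟨ *-monoˡ-≤ c (proj₂ (dichotomy L (suc m) p)) ⟩
    B * (A * A ^ j) * M ^ r * c               ≡⟨ lem₄ B A (A ^ j) (M ^ r) c ⟩
    B * A ^ j * c * (A * M ^ r)               ∎)
    where
    open ≤-Reasoning
    L = j + l
    M = suc (m + L)
    c₀ = (m + l) C l
    c₁ = (m + L) C L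
    c = suc (m + L) C L
    lem₁ : ∀ q c a M p → q * c * (a * (M * p)) ≡ a * q * M * (c * p)
    lem₁ = solve-∀
    lem₂ : ∀ q M c x → q * M * (c * x) ≡ q * x * (M * c)
    lem₂ = solve-∀
    lem₃ : ∀ q x m c → q * x * (m * c) ≡ q * (x * m) * c
    lem₃ = solve-∀
    lem₄ : ∀ b a aj m c → b * (a * aj) * m * c ≡ b * aj * c * (a * m)
    lem₄ = solve-∀

  -- Induction on the first letter, for hit ≤ β^t C(m + l, l). From level t + 1, a one leads to at
  -- most β^t C(m + l, l) words; by `C-decay` a zero leads to at most B / A times as many, and 1 + B
  -- / A = β.
  hit-bound : ∀ n t l m → n ≡ m + (t + l) → Small l m →
    A ^ t * hit j n t (t + l) ≤ Q ^ t * ((m + l) C l)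
  hit-bound n zero l m refl s = ≤-refl
  hit-bound zero (suc t) l m e s = ≤-trans (≤-reflexive (*-zeroʳ (A ^ suc t))) z≤n
  hit-bound (suc n) (suc t) l m e s = begin
    A * A ^ t * (h₁ + h₀)             ≡⟨ lem₁ A (A ^ t) h₁ h₀ ⟩
    A * (A ^ t * h₁) + A * A ^ t * h₀ ≤⟨ +-mono-≤ (*-monoʳ-≤ A (hit-bound n t l m e′ s)) up ⟩
    A * (Q ^ t * c) + B * Q ^ t * c   ≡⟨ lem₂ A B (Q ^ t) c ⟩
    Q * Q ^ t * c                     ∎
    where
    open ≤-Reasoning
    h₁ = hit j n t (t + l)
    h₀ = hit j n (suc (j + t)) (suc (t + l))
    c = (m + l) C l
    lem₁ : ∀ a x h k → a * x * (h + k) ≡ a * (x * h) + a * x * k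
    lem₁ = solve-∀
    lem₂ : ∀ a b x c → a * (x * c) + b * x * c ≡ (a + b) * x * c
    lem₂ = solve-∀
    e′ : n ≡ m + (t + l)
    e′ = suc-injective (trans e (+-suc m (t + l)))
    none : h₀ ≡ 0 → A * A ^ t * h₀ ≤ B * Q ^ t * c
    none q = ≤-trans (≤-reflexive (trans (cong (A * A ^ t *_) q) (*-zeroʳ (A * A ^ t)))) z≤n
    some : ∀ l₀ m₀ → j + l₀ ≡ l → m ≡ suc m₀ → A * A ^ t * h₀ ≤ B * Q ^ t * c
    some l₀ m₀ refl refl = *-cancelˡ-≤ (A ^ j) {{m^n≢0 A j}} (begin
      A ^ j * (A * A ^ t * h₀)          ≡⟨ lem₃ (A ^ j) A (A ^ t) h₀ ⟩
      A * (A ^ j * A ^ t) * h₀          ≡⟨ cong (λ x → A * x * h₀) (^-distribˡ-+-* A j t) ⟨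
      A ^ suc (j + t) * h₀              ≡⟨ cong (λ u → A ^ suc (j + t) * hit j n (suc (j + t)) u) level ⟩
      A ^ suc (j + t) * hit j n (suc (j + t)) (suc (j + t) + l₀)
        ≤⟨ hit-bound n (suc (j + t)) l₀ m₀ word-length (small-down l₀ m₀ s) ⟩
      Q ^ suc (j + t) * ((m₀ + l₀) C l₀) ≡⟨ cong (λ x → Q * x * c₀) (^-distribˡ-+-* Q j t) ⟩
      Q * (Q ^ j * Q ^ t) * c₀          ≡⟨ lem₄ Q (Q ^ j) (Q ^ t) c₀ ⟩
      Q ^ t * (Q ^ r * c₀)              ≤⟨ *-monoʳ-≤ (Q ^ t) (C-decay l₀ m₀ s) ⟩
      Q ^ t * (B * A ^ j * c)           ≡⟨ lem₅ (Q ^ t) B (A ^ j) c ⟩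
      A ^ j * (B * Q ^ t * c)           ∎)
      where
      c₀ = (m₀ + l₀) C l₀
      lem₃ : ∀ x a y h → x * (a * y * h) ≡ a * (x * y) * h
      lem₃ = solve-∀
      lem₄ : ∀ q x y c → q * (x * y) * c ≡ y * (q * x * c)
      lem₄ = solve-∀
      lem₅ : ∀ q b a c → q * (b * a * c) ≡ a * (b * q * c)
      lem₅ = solve-∀
      level′ : ∀ t j l₀ → suc (t + (j + l₀)) ≡ suc (j + t) + l₀
      level′ = solve-∀
      level : suc (t + (j + l₀)) ≡ suc (j + t) + l₀
      level = level′ t j l₀
      word-length : n ≡ m₀ + (suc (j + t) + l₀)
      word-length = trans e′ (trans (sym (+-suc m₀ _)) (cong (m₀ +_) level))
    up : A * A ^ t * h₀ ≤ B * Q ^ t * c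
    up with j ≤? l
    -- Too few ones remain to come down from the raised level.
    up | no j≰l = none (hit-few j n (suc (j + t)) (suc (t + l))
      (s≤s (subst (t + l <_) (+-comm t j) (+-monoʳ-< t (≰⇒> j≰l)))))
    up | yes j≤l = go m refl
      where
      go : ∀ m₀ → m ≡ m₀ → A * A ^ t * h₀ ≤ B * Q ^ t * c
      -- With no zero to spend, the rest would need more ones than it has letters.
      go zero eq = none (n≤0⇒n≡0 (subst (h₀ ≤_) (k>n⇒nCk≡0 (s≤s (≤-reflexive
        (trans e′ (cong (_+ (t + l)) eq))))) (hit≤C j n (suc (j + t)) (suc (t + l)))))
      go (suc m₀) eq = some (l ∸ j) m₀ (m+[n∸m]≡n j≤l) eq

  -- A^t (1 + β + ... + β^t), cleared of denominators.
  geometric : ℕ → ℕ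
  geometric zero    = 1
  geometric (suc t) = A * geometric t + Q ^ suc t

  geometric-sum : ∀ t → B * geometric t + A ^ suc t ≡ Q ^ suc t
  geometric-sum zero = lem A B
    where
    lem : ∀ a b → b * 1 + a * 1 ≡ (a + b) * 1
    lem = solve-∀
  geometric-sum (suc t) = begin
    B * (A * g + Q ^ suc t) + A * A ^ suc t         ≡⟨ lem A B g (Q ^ suc t) (A ^ suc t) ⟩
    A * (B * g + A ^ suc t) + B * Q ^ suc t         ≡⟨ cong (λ x → A * x + B * Q ^ suc t) (geometric-sum t) ⟩
    A * Q ^ suc t + B * Q ^ suc t                   ≡⟨ *-distribʳ-+ (Q ^ suc t) A B ⟨
    Q * Q ^ suc t                                   ∎
    where
    open ≡-Reasoning
    g = geometric t
    lem : ∀ a b g q x → b * (a * g + q) + a * x ≡ a * (b * g + x) + b * q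
    lem = solve-∀

  -- A word off the star has fewer than `t` ones before its first zero, hence a level from j + 1 to
  -- j + t after it. `hit-bound` at these levels, and at level `j` for the second summand, adds up
  -- to the geometric sum.
  hit-total : ∀ t l m → Small (j + l) (suc m) →
    A ^ (j + t) * (hit j (t + suc (m + (j + l))) t (t + (j + l)) + hit j (m + (j + l)) j (j + l))
    ≤ A ^ (j + t) * (suc (m + (j + l)) C (j + l)) + geometric t * (Q ^ j * ((m + l) C l))
  hit-total zero l m s = subst (λ x → A ^ x * (c + h) ≤ A ^ x * c + 1 * (Q ^ j * c₀))
    (sym (+-identityʳ j)) (begin
      A ^ j * (c + h)            ≡⟨ *-distribˡ-+ (A ^ j) c h ⟩
      A ^ j * c + A ^ j * h      ≤⟨ +-monoʳ-≤ (A ^ j * c)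
                                      (hit-bound (m + (j + l)) j l m refl (small-down l m s)) ⟩
      A ^ j * c + Q ^ j * c₀     ≡⟨ cong (A ^ j * c +_) (+-identityʳ _) ⟨
      A ^ j * c + 1 * (Q ^ j * c₀) ∎)
    where
    open ≤-Reasoning
    c = suc (m + (j + l)) C (j + l)
    c₀ = (m + l) C l
    h = hit j (m + (j + l)) j (j + l)
  hit-total (suc t) l m s = subst
    (λ x → A ^ x * (h₁ + h₀ + h) ≤ A ^ x * c + (A * g + Q * Q ^ t) * (Q ^ j * c₀))
    (sym (+-suc j t)) (begin
      A * a * (h₁ + h₀ + h)                            ≡⟨ lem₁ A a h₁ h₀ h ⟩
      A * (a * (h₁ + h)) + A * a * h₀                  ≤⟨ +-mono-≤ (*-monoʳ-≤ A (hit-total t l m s)) last ⟩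
      A * (a * c + g * (Q ^ j * c₀)) + Q * (Q ^ j * Q ^ t) * c₀
        ≡⟨ lem₂ A a c g (Q ^ j) c₀ Q (Q ^ t) ⟩
      A * a * c + (A * g + Q * Q ^ t) * (Q ^ j * c₀)   ∎)
    where
    open ≤-Reasoning
    L = j + l
    a = A ^ (j + t)
    g = geometric t
    c = suc (m + L) C L
    c₀ = (m + l) C l
    h₁ = hit j (t + suc (m + L)) t (t + L)
    h₀ = hit j (t + suc (m + L)) (suc (j + t)) (suc (t + L))
    h = hit j (m + L) j L
    lem₁ : ∀ x a h k e → x * a * (h + k + e) ≡ x * (a * (h + e)) + x * a * k
    lem₁ = solve-∀
    lem₂ : ∀ x a c g y z q w → x * (a * c + g * (y * z)) + q * (y * w) * z
      ≡ x * a * c + (x * g + q * w) * (y * z)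
    lem₂ = solve-∀
    level : ∀ t j l → suc (t + (j + l)) ≡ suc (j + t) + l
    level = solve-∀
    word-length : ∀ t m j l → t + suc (m + (j + l)) ≡ m + (suc (j + t) + l)
    word-length = solve-∀
    last : A * a * h₀ ≤ Q * (Q ^ j * Q ^ t) * c₀
    last = begin
      A * a * h₀
        ≡⟨ cong (λ u → A ^ suc (j + t) * hit j (t + suc (m + L)) (suc (j + t)) u) (level t j l) ⟩
      A ^ suc (j + t) * hit j (t + suc (m + L)) (suc (j + t)) (suc (j + t) + l)
        ≤⟨ hit-bound (t + suc (m + L)) (suc (j + t)) l m (word-length t m j l) (small-down l m s) ⟩
      Q ^ suc (j + t) * c₀
        ≡⟨ cong (λ x → Q * x * c₀) (^-distribˡ-+-* Q j t) ⟩
      Q * (Q ^ j * Q ^ t) * c₀ ∎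

  module _ (t : ℕ) (Q^≤2A^ : Q ^ suc t ≤ 2 * A ^ suc t) where

    -- The sum is (β^(t+1) - 1) / (β - 1) in units of A^t; its numerator is at most 1, and β - 1 = B
    -- / A.
    geometric-bound : B * geometric t ≤ A ^ suc t
    geometric-bound = +-cancelʳ-≤ (A ^ suc t) _ _ (begin
      B * geometric t + A ^ suc t    ≡⟨ geometric-sum t ⟩
      Q ^ suc t                      ≤⟨ Q^≤2A^ ⟩
      2 * A ^ suc t                  ≡⟨ cong (A ^ suc t +_) (+-identityʳ _) ⟩
      A ^ suc t + A ^ suc t          ∎)
      where open ≤-Reasoning

    -- The geometric sum is at most A / B, and `ratio` gives C(m + l, l) ≤ (L / M)^j C(m + L, L).
    -- The first half of `dichotomy` says that (A / B) β^j (L / M)^j ≤ 1.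
    geometric-decay : ∀ l m → Small (j + l) (suc m) →
      geometric t * (Q ^ j * ((m + l) C l)) ≤ A ^ (j + t) * ((m + (j + l)) C (j + l))
    geometric-decay l m (p , w) =
      *-cancelʳ-≤ _ _ (B * M ^ j) {{m*n≢0 B (M ^ j) {{B≢0}} {{m^n≢0 M j}}}} (begin
      g * (Q ^ j * c₀) * (B * M ^ j)       ≡⟨ lem₁ g (Q ^ j) c₀ B (M ^ j) ⟩
      B * g * Q ^ j * (c₀ * M ^ j)         ≤⟨ *-mono-≤ (*-monoˡ-≤ (Q ^ j) geometric-bound) (ratio j m l 2≤j w) ⟩
      A * A ^ t * Q ^ j * (c₁ * L ^ j)     ≡⟨ lem₂ A (A ^ t) (Q ^ j) c₁ (L ^ j) ⟩
      A ^ t * c₁ * (A * Q ^ j * L ^ j)     ≤⟨ *-monoʳ-≤ (A ^ t * c₁) (proj₁ (dichotomy L (suc m) p)) ⟩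
      A ^ t * c₁ * (B * A ^ j * M ^ j)     ≡⟨ lem₃ (A ^ t) c₁ B (A ^ j) (M ^ j) ⟩
      A ^ j * A ^ t * c₁ * (B * M ^ j)     ≡⟨ cong (λ x → x * c₁ * (B * M ^ j)) (^-distribˡ-+-* A j t) ⟨
      A ^ (j + t) * c₁ * (B * M ^ j)       ∎)
      where
      open ≤-Reasoning
      L = j + l
      M = suc (m + L)
      g = geometric t
      c₀ = (m + l) C l
      c₁ = (m + L) C L
      lem₁ : ∀ g q c b x → g * (q * c) * (b * x) ≡ b * g * q * (c * x)
      lem₁ = solve-∀
      lem₂ : ∀ a x q c l → a * x * q * (c * l) ≡ x * c * (a * q * l)
      lem₂ = solve-∀
      lem₃ : ∀ x c b y m → x * c * (b * y * m) ≡ y * x * c * (b * m)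
      lem₃ = solve-∀

    -- This is E ≤ K without subtraction, as K = C(m + l, l) - `hit j (m + l) j l`. For l < j there
    -- are no excess words at all.
    hit-pair : ∀ l m → Small l (suc m) →
      hit j (t + suc (m + l)) t (t + l) + hit j (m + l) j l ≤ suc (m + l) C l + (m + l) C l
    hit-pair l m s with j ≤? l
    ... | yes j≤l = subst Pair (m+[n∸m]≡n j≤l) pair s
      where
      open ≤-Reasoning
      Pair : ℕ → Set
      Pair l = Small l (suc m) → hit j (t + suc (m + l)) t (t + l) + hit j (m + l) j l
        ≤ suc (m + l) C l + (m + l) C l
      l₀ = l ∸ j
      L = j + l₀
      pair : Pair L
      pair s = *-cancelˡ-≤ (A ^ (j + t)) {{m^n≢0 A (j + t)}} (begin
        A ^ (j + t) * (hit j (t + suc (m + L)) t (t + L) + hit j (m + L) j L)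
          ≤⟨ hit-total t l₀ m s ⟩
        A ^ (j + t) * (suc (m + L) C L) + geometric t * (Q ^ j * ((m + l₀) C l₀))
          ≤⟨ +-monoʳ-≤ (A ^ (j + t) * (suc (m + L) C L)) (geometric-decay l₀ m s) ⟩
        A ^ (j + t) * (suc (m + L) C L) + A ^ (j + t) * ((m + L) C L)
          ≡⟨ *-distribˡ-+ (A ^ (j + t)) (suc (m + L) C L) ((m + L) C L) ⟨
        A ^ (j + t) * (suc (m + L) C L + (m + L) C L) ∎)
    ... | no j≰l = +-mono-≤ (only-star t) (hit≤C j (m + l) j l)
      where
      only-star : ∀ t → hit j (t + suc (m + l)) t (t + l) ≤ suc (m + l) C l
      only-star zero = ≤-refl
      only-star (suc t) = subst (_≤ suc (m + l) C l) (sym (trans (cong (hit j (t + suc (m + l)) t (t + l) +_)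
        (hit-few j (t + suc (m + l)) (suc (j + t)) (suc (t + l))
          (s≤s (subst (t + l <_) (+-comm t j) (+-monoʳ-< t (≰⇒> j≰l)))))) (+-identityʳ _)))
        (only-star t)

-- Numerical bounds

private
  -- Multiplying 1 + y + 3 y² / 4, where y = i B / A, by 1 + B / A creates one cubic term; 3 y ≤ 2
  -- turns it into part of the growth of the quadratic term as i becomes i + 1.
  quadratic : ∀ A B i → 3 * (i * B) ≤ 2 * A →
    4 * (A * A) * (A + B) ^ i ≤ A ^ i * (4 * (A * A) + 4 * (i * B) * A + 3 * (i * B * (i * B)))
  quadratic A B zero le = ≤-reflexive (lem A)
    where
    lem : ∀ A → 4 * (A * A) * 1 ≡ 1 * (4 * (A * A) + 0 + 0)
    lem = solve-∀
  quadratic A B (suc i) le = begin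
    4 * (A * A) * ((A + B) * (A + B) ^ i)     ≡⟨ lem₁ (4 * (A * A)) (A + B) ((A + B) ^ i) ⟩
    (A + B) * (4 * (A * A) * (A + B) ^ i)     ≤⟨ *-monoʳ-≤ (A + B) (quadratic A B i le′) ⟩
    (A + B) * (A ^ i * E i)                   ≡⟨ lem₁ (A + B) (A ^ i) (E i) ⟩
    A ^ i * ((A + B) * E i)                   ≤⟨ *-monoʳ-≤ (A ^ i) step ⟩
    A ^ i * (A * E (suc i))                   ≡⟨ lem₃ (A ^ i) A (E (suc i)) ⟩
    A * A ^ i * E (suc i)                     ∎
    where
    open ≤-Reasoning
    E : ℕ → ℕ
    E i = 4 * (A * A) + 4 * (i * B) * A + 3 * (i * B * (i * B))
    le′ : 3 * (i * B) ≤ 2 * A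
    le′ = ≤-trans (*-monoʳ-≤ 3 (m≤n+m (i * B) B)) le
    lem₁ : ∀ a b c → a * (b * c) ≡ b * (a * c)
    lem₁ = solve-∀
    lem₃ : ∀ a b c → a * (b * c) ≡ b * a * c
    lem₃ = solve-∀
    lem₄ : ∀ A B i → (A + B) * (4 * (A * A) + 4 * (i * B) * A + 3 * (i * B * (i * B)))
      ≡ A * (4 * (A * A) + 4 * (i * B) * A + 3 * (i * B * (i * B))) + 4 * (A * A) * B
        + 4 * (i * B) * A * B + 3 * (i * B) * (i * B * B)
    lem₄ = solve-∀
    lem₅ : ∀ A B i → A * (4 * (A * A) + 4 * ((B + i * B)) * A + 3 * ((B + i * B) * (B + i * B)))
      ≡ A * (4 * (A * A) + 4 * (i * B) * A + 3 * (i * B * (i * B))) + 4 * (A * A) * B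
        + 4 * (i * B) * A * B + 2 * A * (i * B * B) + 3 * A * (B * B)
    lem₅ = solve-∀
    step : (A + B) * E i ≤ A * E (suc i)
    step = begin
      (A + B) * E i                                         ≡⟨ lem₄ A B i ⟩
      A * E i + 4 * (A * A) * B + 4 * (i * B) * A * B + 3 * (i * B) * (i * B * B)
        ≤⟨ +-monoʳ-≤ (A * E i + 4 * (A * A) * B + 4 * (i * B) * A * B) (*-monoˡ-≤ (i * B * B) le′) ⟩
      A * E i + 4 * (A * A) * B + 4 * (i * B) * A * B + 2 * A * (i * B * B)
        ≤⟨ m≤m+n _ (3 * A * (B * B)) ⟩
      A * E i + 4 * (A * A) * B + 4 * (i * B) * A * B + 2 * A * (i * B * B) + 3 * A * (B * B)
        ≡⟨ lem₅ A B i ⟨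
      A * E (suc i)                                         ∎

-- (1 + y/i)^i ≤ 1 + y + 3y²/4 as long as y ≤ 2/3, where y = i B / A.
[A+B]^≤2A^ : ∀ A B i → 1 ≤ A → 3 * (i * B) ≤ 2 * A → (A + B) ^ i ≤ 2 * A ^ i
[A+B]^≤2A^ A B i 1≤A le = *-cancelˡ-≤ (12 * (A * A))
  {{m*n≢0 12 (A * A) {{_}} {{m*n≢0 A A {{>-nonZero 1≤A}} {{>-nonZero 1≤A}}}}}} (begin
  12 * (A * A) * (A + B) ^ i               ≡⟨ lem₁ A ((A + B) ^ i) ⟩
  3 * (4 * (A * A) * (A + B) ^ i)          ≤⟨ *-monoʳ-≤ 3 (quadratic A B i le) ⟩
  3 * (A ^ i * (4 * (A * A) + 4 * y * A + 3 * (y * y)))  ≡⟨ lem₂ A (A ^ i) y ⟩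
  A ^ i * (12 * (A * A) + 4 * A * (3 * y) + 3 * y * (3 * y))
    ≤⟨ *-monoʳ-≤ (A ^ i) (+-mono-≤ (+-monoʳ-≤ (12 * (A * A)) (*-monoʳ-≤ (4 * A) le)) (*-mono-≤ le le)) ⟩
  A ^ i * (12 * (A * A) + 4 * A * (2 * A) + 2 * A * (2 * A)) ≡⟨ lem₃ A (A ^ i) ⟩
  12 * (A * A) * (2 * A ^ i)               ∎)
  where
  open ≤-Reasoning
  y = i * B
  lem₁ : ∀ A q → 12 * (A * A) * q ≡ 3 * (4 * (A * A) * q)
  lem₁ = solve-∀
  lem₂ : ∀ A p y → 3 * (p * (4 * (A * A) + 4 * y * A + 3 * (y * y)))
    ≡ p * (12 * (A * A) + 4 * A * (3 * y) + 3 * y * (3 * y))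
  lem₂ = solve-∀
  lem₃ : ∀ A p → p * (12 * (A * A) + 4 * A * (2 * A) + 2 * A * (2 * A)) ≡ 12 * (A * A) * (2 * p)
  lem₃ = solve-∀

3⌈j/2⌉≤2j : ∀ j → 2 ≤ j → 3 * ⌈ j /2⌉ ≤ 2 * j
3⌈j/2⌉≤2j 1 (s≤s ())
3⌈j/2⌉≤2j 2 _ = s≤s (s≤s (s≤s z≤n))
3⌈j/2⌉≤2j 3 _ = ≤-refl
3⌈j/2⌉≤2j (suc (suc j@(suc (suc _)))) _ = begin
  3 * suc ⌈ j /2⌉         ≡⟨ *-suc 3 ⌈ j /2⌉ ⟩
  3 + 3 * ⌈ j /2⌉         ≤⟨ +-mono-≤ (n≤1+n 3) (3⌈j/2⌉≤2j j (s≤s (s≤s z≤n))) ⟩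
  4 + 2 * j               ≡⟨ lem j ⟩
  2 * (2 + j)             ∎
  where
  open ≤-Reasoning
  lem : ∀ j → 4 + 2 * j ≡ 2 * (2 + j)
  lem = solve-∀

-- With A = j and B = 1, `[A+B]^≤2A^` allows exponents up to 2 j / 3. The exponent `j` is therefore
-- split into two halves, each contributing a factor 2.
[1+j]^j≤4j^j : ∀ j → 2 ≤ j → suc j ^ j ≤ 4 * j ^ j
[1+j]^j≤4j^j j 2≤j = begin
  suc j ^ j                                        ≡⟨ cong (suc j ^_) (⌊n/2⌋+⌈n/2⌉≡n j) ⟨
  suc j ^ (⌊ j /2⌋ + ⌈ j /2⌉)                      ≡⟨ ^-distribˡ-+-* (suc j) ⌊ j /2⌋ ⌈ j /2⌉ ⟩
  suc j ^ ⌊ j /2⌋ * suc j ^ ⌈ j /2⌉                ≤⟨ *-mono-≤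
    (bound ⌊ j /2⌋ (≤-trans (*-monoʳ-≤ 3 (⌊n/2⌋≤⌈n/2⌉ j)) (3⌈j/2⌉≤2j j 2≤j)))
    (bound ⌈ j /2⌉ (3⌈j/2⌉≤2j j 2≤j)) ⟩
  2 * j ^ ⌊ j /2⌋ * (2 * j ^ ⌈ j /2⌉)              ≡⟨ lem (j ^ ⌊ j /2⌋) (j ^ ⌈ j /2⌉) ⟩
  4 * (j ^ ⌊ j /2⌋ * j ^ ⌈ j /2⌉)                  ≡⟨ cong (4 *_) (^-distribˡ-+-* j ⌊ j /2⌋ ⌈ j /2⌉) ⟨
  4 * j ^ (⌊ j /2⌋ + ⌈ j /2⌉)                      ≡⟨ cong (λ x → 4 * j ^ x) (⌊n/2⌋+⌈n/2⌉≡n j) ⟩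
  4 * j ^ j                                        ∎
  where
  open ≤-Reasoning
  lem : ∀ a b → 2 * a * (2 * b) ≡ 4 * (a * b)
  lem = solve-∀
  bound : ∀ i → 3 * i ≤ 2 * j → suc j ^ i ≤ 2 * j ^ i
  bound i le = subst (λ x → x ^ i ≤ 2 * j ^ i) (+-comm j 1)
    ([A+B]^≤2A^ j 1 i (≤-trans (s≤s z≤n) 2≤j) (subst (λ x → 3 * x ≤ 2 * j) (sym (*-identityʳ i)) le))

module Threshold (i A B l m : ℕ) (1≤i : 1 ≤ i) (1≤B : 1 ≤ B) (4B≤A : 4 * B ≤ A)
  (above : A * l ^ suc i ≤ B * m ^ suc i) where

  private
    j r : ℕ
    j = suc i
    r = suc j

  4l^≤m^ : 4 * l ^ j ≤ m ^ j
  4l^≤m^ = *-cancelˡ-≤ B {{>-nonZero 1≤B}} (begin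
    B * (4 * l ^ j)     ≡⟨ lem B (l ^ j) ⟩
    4 * B * l ^ j       ≤⟨ *-monoˡ-≤ (l ^ j) 4B≤A ⟩
    A * l ^ j           ≤⟨ above ⟩
    B * m ^ j           ∎)
    where
    open ≤-Reasoning
    lem : ∀ b x → b * (4 * x) ≡ 4 * b * x
    lem = solve-∀

  root : ∀ x y → x ^ j ≤ y ^ j → x ≤ y
  root x y le = ≮⇒≥ (λ y<x → <⇒≱ (^-monoˡ-< j y<x) le)

  -- Compared after raising to the power `j`: r^j ≤ 4 j^j, and 4 l^j ≤ m^j by the threshold. The
  -- inequality `room` reduces to this one.
  rl≤jm : r * l ≤ j * m
  rl≤jm = root (r * l) (j * m) (begin
    (r * l) ^ j           ≡⟨ ^-distribʳ-* r l j ⟩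
    r ^ j * l ^ j         ≤⟨ *-monoˡ-≤ (l ^ j) ([1+j]^j≤4j^j j (s≤s 1≤i)) ⟩
    4 * j ^ j * l ^ j     ≡⟨ lem (j ^ j) (l ^ j) ⟩
    j ^ j * (4 * l ^ j)   ≤⟨ *-monoʳ-≤ (j ^ j) 4l^≤m^ ⟩
    j ^ j * m ^ j         ≡⟨ ^-distribʳ-* j m j ⟨
    (j * m) ^ j           ∎)
    where
    open ≤-Reasoning
    lem : ∀ a b → 4 * a * b ≡ a * (4 * b)
    lem = solve-∀

  wide : Wide j l m
  wide = *-cancelˡ-≤ j (≤-trans (*-monoˡ-≤ l (n≤1+n j)) rl≤jm) , λ e → root (2 * l) m (begin
    (2 * l) ^ j           ≡⟨ ^-distribʳ-* 2 l j ⟩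
    -- For j = 2 the constant 4 is exactly 2^j.
    2 ^ j * l ^ j         ≡⟨ cong (λ x → 2 ^ x * l ^ j) e ⟩
    4 * l ^ j             ≤⟨ 4l^≤m^ ⟩
    m ^ j                 ∎)
    where open ≤-Reasoning

  room : ∀ t → j * l + r * (t + l) ≤ j * (t + (m + l)) + t
  room t = subst₂ _≤_ (lem₁ i l t) (lem₂ i l t m) (+-monoʳ-≤ (j * l + r * t) rl≤jm)
    where
    lem₁ : ∀ i l t → suc i * l + suc (suc i) * t + suc (suc i) * l
      ≡ suc i * l + suc (suc i) * (t + l)
    lem₁ = solve-∀
    lem₂ : ∀ i l t m → suc i * l + suc (suc i) * t + suc i * m ≡ suc i * (t + (m + l)) + t
    lem₂ = solve-∀

-- The bound for families

hit-mono : ∀ j n l τ → hit j (suc n) 1 (suc l) ≤ hit j (suc τ + n) (suc τ) (suc τ + l)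
hit-mono j n l zero    = ≤-refl
hit-mono j n l (suc τ) = ≤-trans (hit-mono j n l τ) (m≤m+n _ _)

cnt≤1 : ∀ {n} k (f : Family n) → n ≡ k → cnt k f ≤ 1
cnt≤1 k f refl = subst (cnt k f ≤_) (nCn≡1 k) (cnt≤C k f)

cross⇒cnt≤C-t≥2 : ∀ i A B t l m → 1 ≤ i → 1 ≤ t → 1 ≤ B → 4 * B ≤ A →
  (A + B) ^ suc t ≤ 2 * A ^ suc t → A * l ^ suc i ≤ B * suc m ^ suc i →
  (f : Family (t + suc (m + l))) → Cross (suc (suc i)) t f ⊤ → cnt (t + l) f ≤ suc (m + l) C l
cross⇒cnt≤C-t≥2 i A B (suc τ) l m 1≤i _ 1≤B 4B≤A pow above f cf
  with compress (suc (suc i)) (suc τ) f cf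
... | g , sh , cg , e = subst (_≤ suc (m + l) C l) (e (suc τ + l))
  (cnt≤star i (m + l) l (suc τ) g sh cg (room (suc τ)) few nonhit≥1)
  where
  open ≤-Reasoning
  open Threshold i A B l (suc m) 1≤i 1≤B 4B≤A above
  j = suc i
  N = m + l
  B≤A : B ≤ A
  B≤A = ≤-trans (m≤m+n B _) 4B≤A
  BQ≤A² : B * (A + B) ≤ A * A
  BQ≤A² = begin
    B * (A + B)       ≤⟨ *-monoʳ-≤ B (+-monoʳ-≤ A B≤A) ⟩
    B * (A + A)       ≡⟨ lem A B ⟩
    2 * B * A         ≤⟨ *-monoˡ-≤ A (≤-trans (*-monoˡ-≤ B {2} {4} (s≤s (s≤s z≤n))) 4B≤A) ⟩
    A * A             ∎
    where
    lem : ∀ A B → B * (A + A) ≡ 2 * B * A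
    lem = solve-∀
  open Decay j A B (s≤s 1≤i) 1≤B B≤A BQ≤A² using (hit-pair)
  H = hit j (suc τ + suc N) (suc τ) (suc τ + l)
  h = hit j N j l
  c = suc N C l
  pair : H + h ≤ c + N C l
  pair = hit-pair (suc τ) pow l m (above , wide)
  few : H ≤ c + nonhit j N j l
  few = +-cancelʳ-≤ h _ _ (begin
    H + h                          ≤⟨ pair ⟩
    c + N C l                      ≡⟨ cong (c +_) (trans (sym (hit+nonhit j N j l)) (+-comm h _)) ⟩
    c + (nonhit j N j l + h)       ≡⟨ +-assoc c _ h ⟨
    c + nonhit j N j l + h         ∎)
  -- Besides the star words, `H` counts the words 1...1 0 1 w with τ leading ones, where w reaches 0
  -- from level `j`.
  c+h≤H : c + h ≤ H
  c+h≤H = begin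
    c + h                                             ≡⟨ cong (λ d → c + hit j N d l) (+-identityʳ j) ⟨
    c + hit j N (j + 0) l                             ≤⟨ +-monoʳ-≤ c (m≤m+n _ _) ⟩
    hit j (suc (suc N)) 1 (suc l)                     ≤⟨ hit-mono j (suc N) l τ ⟩
    H                                                 ∎
  -- If `K` were 0, then h = C(N, l) ≥ 1, yet c + 2 h ≤ H + h ≤ c + h.
  nonhit≥1 : 1 ≤ nonhit j N j l
  nonhit≥1 = n≢0⇒n>0 (λ none → <⇒≱ (C-pos (m≤n+m l m)) (subst (_≤ 0) (full none)
    (+-cancelˡ-≤ (c + N C l) _ _ (begin
      c + N C l + h         ≡⟨ cong (λ x → c + x + h) (full none) ⟨
      c + h + h             ≤⟨ +-monoˡ-≤ h c+h≤H ⟩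
      H + h                 ≤⟨ pair ⟩
      c + N C l             ≡⟨ +-identityʳ _ ⟨
      c + N C l + 0         ∎))))
    where
    full : nonhit j N j l ≡ 0 → h ≡ N C l
    full none = trans (sym (+-identityʳ h)) (trans (cong (h +_) (sym none)) (hit+nonhit j N j l))

cross⇒intersecting : ∀ {n} j k {f : Family n} → Cross (suc (suc j)) 1 f ⊤ → Intersecting k f
cross⇒intersecting j k cf F G _ _ fF fG =
  subst (1 ≤_) (cong ∣_∣ (trans (cong (G ∩_) (∩-identityʳ F)) (∩-comm G F)))
    (cross-diag j (cf F fF) fG)

-- As B < A, the threshold rules out m < l; hence n ≥ 2 k for k = l + 1, the range of the
-- Erdős-Ko-Rado theorem.
cross⇒cnt≤C-t≡1 : ∀ j A B l m → B < A → A * l ^ suc j ≤ B * suc m ^ suc j →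
  (f : Family (1 + suc (m + l))) → Cross (suc (suc j)) 1 f ⊤ → cnt (1 + l) f ≤ suc (m + l) C l
cross⇒cnt≤C-t≡1 j A B l m B<A above f cf with compress (suc (suc j)) 1 f cf
... | g , sh , cg , e = subst (_≤ suc (m + l) C l) (e (suc l))
  (erdős-ko-rado (suc (m + l)) l g large sh (cross⇒intersecting j (suc l) cg))
  where
  l≤m : l ≤ m
  l≤m = ≮⇒≥ (λ m<l → <⇒≱ (begin-strict
    B * suc m ^ suc j     ≤⟨ *-monoʳ-≤ B (^-monoˡ-≤ (suc j) m<l) ⟩
    B * l ^ suc j         <⟨ *-monoˡ-< (l ^ suc j) {{m^n≢0 l (suc j) {{>-nonZero (≤-trans z<s m<l)}}}} B<A ⟩
    A * l ^ suc j         ∎) above)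
    where open ≤-Reasoning
  large : suc l + suc l ≤ suc (suc (m + l))
  large = s≤s (subst (_≤ suc (m + l)) (sym (+-suc l l)) (s≤s (+-monoˡ-≤ l l≤m)))

cross⇒cnt≤C : ∀ i A B t l m → 1 ≤ i → 1 ≤ t → 1 ≤ B → B < A →
  (2 ≤ t → 4 * B ≤ A × (A + B) ^ suc t ≤ 2 * A ^ suc t) →
  A * l ^ suc i ≤ B * m ^ suc i → ∀ n → n ≡ t + (m + l) →
  (f : Family n) → Cross (suc (suc i)) t f ⊤ → cnt (t + l) f ≤ (m + l) C l
-- Here the threshold forces l = 0, so n = k = t and the whole ground set is the only possible
-- member.
cross⇒cnt≤C i A B t l zero 1≤i 1≤t 1≤B B<A large above n refl f cf
  with m^n≡0⇒m≡0 l (suc i) (m*n≡0⇒m≡0 (l ^ suc i) A {{>-nonZero (≤-trans z<s B<A)}}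
         (trans (*-comm (l ^ suc i) A) (n≤0⇒n≡0 (subst (A * l ^ suc i ≤_) (*-zeroʳ B) above))))
... | refl = cnt≤1 (t + 0) f refl
cross⇒cnt≤C i A B 1 l (suc m) 1≤i 1≤t 1≤B B<A large above n refl f cf =
  cross⇒cnt≤C-t≡1 i A B l m B<A above f cf
cross⇒cnt≤C i A B t@(suc (suc _)) l (suc m) 1≤i 1≤t 1≤B B<A large above n refl f cf =
  cross⇒cnt≤C-t≥2 i A B t l m 1≤i 1≤t 1≤B (proj₁ (large (s≤s (s≤s z≤n)))) (proj₂ (large (s≤s (s≤s z≤n))))
    above f cf

-- From lists of sets to families

cross-intro : ∀ {n} j c (f : Family n) X →
  ((Fs : Fin j → Subset n) → (∀ i → f ∋ Fs i) → c ≤ ∣ ⋂ (tabulate Fs) ∩ X ∣) → Cross j c f X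
cross-intro zero c f X p = subst (λ Y → c ≤ ∣ Y ∣) (∩-identityˡ X) (p (λ ()) (λ ()))
cross-intro (suc j) c f X p F fF = cross-intro j c f (F ∩ X) λ Fs q →
  subst (λ Y → c ≤ ∣ Y ∣)
    (trans (cong (_∩ X) (∩-comm F (⋂ (tabulate Fs)))) (∩-assoc (⋂ (tabulate Fs)) F X))
    (p (λ { zero → F ; (suc i) → Fs i }) (λ { zero → fF ; (suc i) → q i }))

module _ {n : ℕ} where

  open import Data.List.Membership.DecPropositional (Vec.≡-dec {n = n} Bool._≟_) using (_∈?_)

  family : List (Subset n) → Family n
  family 𝓕 F = does (F ∈? 𝓕)

  ∈⇒family : ∀ {F 𝓕} → F ∈ 𝓕 → family 𝓕 ∋ F
  ∈⇒family {F} {𝓕} = dec-true (F ∈? 𝓕)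

  ∉⇒family : ∀ {F 𝓕} → ¬ F ∈ 𝓕 → family 𝓕 F ≡ false
  ∉⇒family {F} {𝓕} = dec-false (F ∈? 𝓕)

  family⇒∈ : ∀ {F 𝓕} → family 𝓕 ∋ F → F ∈ 𝓕
  family⇒∈ {F} {𝓕} e with F ∈? 𝓕
  ... | yes p = p

cnt-mono : ∀ {n} k {f g : Family n} → (∀ F → f ∋ F → g ∋ F) → cnt k f ≤ cnt k g
cnt-mono {zero} zero {f} {g} p with f [] in eq
... | false = z≤n
... | true rewrite p [] eq = ≤-refl
cnt-mono {zero} (suc k) p = z≤n
cnt-mono {suc n} zero p = cnt-mono {n} zero (λ F → p (false ∷ F))
cnt-mono {suc n} (suc k) p =
  +-mono-≤ (cnt-mono k (λ F → p (true ∷ F))) (cnt-mono (suc k) (λ F → p (false ∷ F)))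

cnt-mono-< : ∀ {n} {f g : Family n} → (∀ F → f ∋ F → g ∋ F) →
  ∀ F → f F ≡ false → g ∋ F → cnt (∣ F ∣) f < cnt (∣ F ∣) g
cnt-mono-< p [] fF gF rewrite fF | gF = ≤-refl
cnt-mono-< p (true ∷ F) fF gF = +-mono-<-≤ (cnt-mono-< (λ G → p (true ∷ G)) F fF gF)
  (cnt-mono (suc ∣ F ∣) (λ G → p (false ∷ G)))
cnt-mono-< {f = f} {g} p (false ∷ F) fF gF = prepend ∣ F ∣ (cnt-mono-< (λ G → p (false ∷ G)) F fF gF)
  where
  prepend : ∀ k → cnt k (f ↾ false) < cnt k (g ↾ false) → cnt k f < cnt k g
  prepend zero    q = q
  prepend (suc k) q = +-mono-≤-< (cnt-mono k (λ G → p (true ∷ G))) q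

-- The list has no repetitions, so each entry raises the count strictly.
length≤cnt : ∀ {n k} (𝓕 : List (Subset n)) → IsKFamily n k 𝓕 → length 𝓕 ≤ cnt k (family 𝓕)
length≤cnt [] _ = z≤n
length≤cnt (F ∷ 𝓕) (fresh ∷ uniq , refl ∷ sizes) = ≤-<-trans (length≤cnt 𝓕 (uniq , sizes))
  (cnt-mono-< (λ G e → ∈⇒family {𝓕 = F ∷ 𝓕} (there (family⇒∈ {𝓕 = 𝓕} e))) F
    (∉⇒family {𝓕 = 𝓕} (All¬⇒¬Any fresh)) (∈⇒family {𝓕 = F ∷ 𝓕} (here refl)))

cross-family : ∀ {n} r {t} (𝓕 : List (Subset n)) → RWiseTIntersecting r t 𝓕 → Cross r t (family 𝓕) ⊤
cross-family r {t} 𝓕 int = cross-intro r t (family 𝓕) ⊤ λ Fs q →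
  subst (λ Y → t ≤ ∣ Y ∣) (sym (∩-identityʳ (⋂ (tabulate Fs)))) (int Fs (λ i → family⇒∈ {𝓕 = 𝓕} (q i)))

length≤starSize : ∀ i a b k t n → 1 ≤ i → 1 ≤ t → 1 ≤ b → b < a * t →
  (2 ≤ t → 4 * b ≤ a * t × (a * t + b) ^ suc t ≤ 2 * (a * t) ^ suc t) →
  AboveThreshold a b (suc (suc i)) t k n →
  (𝓕 : List (Subset n)) → IsKFamily n k 𝓕 → RWiseTIntersecting (suc (suc i)) t 𝓕 →
  length 𝓕 ≤ starSize n k t
length≤starSize i a b k t n 1≤i 1≤t 1≤b b<at large (above , _) 𝓕 isK int with t ≤? k
... | yes t≤k = ≤-trans (length≤cnt 𝓕 isK) (subst₂ (λ x y → cnt x (family 𝓕) ≤ y C (k ∸ t))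
        (m+[n∸m]≡n t≤k) (sym n∸t)
        (cross⇒cnt≤C i (a * t) b t (k ∸ t) (n ∸ k) 1≤i 1≤t 1≤b b<at large (proj₂ (above t≤k)) n n≡
          (family 𝓕) (cross-family (suc (suc i)) 𝓕 int)))
  where
  k≤n = proj₁ (above t≤k)
  n≡ : n ≡ t + (n ∸ k + (k ∸ t))
  n≡ = sym (trans (lem t (n ∸ k) (k ∸ t)) (trans (cong (n ∸ k +_) (m+[n∸m]≡n t≤k)) (m∸n+n≡m k≤n)))
    where
    lem : ∀ t m l → t + (m + l) ≡ m + (t + l)
    lem = solve-∀
  n∸t : n ∸ t ≡ n ∸ k + (k ∸ t)
  n∸t = trans (cong (_∸ t) n≡) (m+n∸m≡n t _)
-- For k < t the list is empty: a member, intersected with itself, would have at least `t` elements.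
... | no t≰k with 𝓕 | isK
...   | []    | _ = z≤n
...   | F ∷ 𝓖 | _ , refl ∷ _ = ⊥-elim (t≰k (subst (λ Y → t ≤ ∣ Y ∣) (∩-identityʳ F)
  (cross-diag (suc i) (cross-family (suc (suc i)) (F ∷ 𝓖) int)
    (∈⇒family {F = F} {𝓕 = F ∷ 𝓖} (here refl)))))

-- The condition of `[A+B]^≤2A^` reads 6 (t + 1) ≤ 10 t, which is true from t = 2 on.
large-5/2 : ∀ t → 2 ≤ t → 4 * 2 ≤ 5 * t × (5 * t + 2) ^ suc t ≤ 2 * (5 * t) ^ suc t
large-5/2 t 2≤t = ≤-trans (m≤m+n 8 2) (*-monoʳ-≤ 5 2≤t) ,
  [A+B]^≤2A^ (5 * t) 2 (suc t) (≤-trans (s≤s z≤n) (*-monoʳ-≤ 5 2≤t))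
    (subst₂ _≤_ (lem₁ t) (lem₂ t) (+-monoʳ-≤ (6 * t) (≤-trans (m≤m+n 6 2) (*-monoʳ-≤ 4 2≤t))))
  where
  lem₁ : ∀ t → 6 * t + 6 ≡ 3 * (suc t * 2)
  lem₁ = solve-∀
  lem₂ : ∀ t → 6 * t + 4 * t ≡ 2 * (5 * t)
  lem₂ = solve-∀

large-2 : ∀ t → 2 ≤ t → 4 * 1 ≤ 2 * t × (2 * t + 1) ^ suc t ≤ 2 * (2 * t) ^ suc t
large-2 1 (s≤s ())
-- The general condition 3 (t + 1) ≤ 4 t starts at t = 3; for t = 2 the powers are compared
-- directly, 5³ = 125 ≤ 128 = 2 · 4³.
large-2 2 _ = ≤-refl , m≤m+n 125 3
large-2 t@(suc (suc (suc t₀))) 2≤t = *-monoʳ-≤ 2 2≤t ,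
  [A+B]^≤2A^ (2 * t) 1 (suc t) (≤-trans (s≤s z≤n) (*-monoʳ-≤ 2 2≤t))
    (subst₂ _≤_ (lem₁ t) (lem₂ t) (+-monoʳ-≤ (3 * t) (s≤s (s≤s (s≤s z≤n)))))
  where
  lem₁ : ∀ t → 3 * t + 3 ≡ 3 * (suc t * 1)
  lem₁ = solve-∀
  lem₂ : ∀ t → 3 * t + t ≡ 2 * (2 * t)
  lem₂ = solve-∀

theorem1p3 : (r k t : ℕ) → r ≥ 3 → k ≥ 1 → t ≥ 1 →
    (n : ℕ) →
    ((((r ≡ 3) ⊎ (r ≡ 4)) × AboveThreshold 5 2 r t k n)
    ⊎ ((r ≥ 5) × AboveThreshold 2 1 r t k n)) →
    (𝓕 : List (Subset n)) → IsKFamily n k 𝓕 → RWiseTIntersecting r t 𝓕 →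
    length 𝓕 ≤ starSize n k t
theorem1p3 (suc (suc (suc i))) k t _ _ t≥1 n (inj₁ (_ , above)) =
  length≤starSize (suc i) 5 2 k t n (s≤s z≤n) t≥1 (s≤s z≤n)
    (≤-trans (m≤m+n 3 2) (*-monoʳ-≤ 5 t≥1)) (large-5/2 t) above
theorem1p3 (suc (suc (suc i))) k t _ _ t≥1 n (inj₂ (_ , above)) =
  length≤starSize (suc i) 2 1 k t n (s≤s z≤n) t≥1 (s≤s z≤n) (*-monoʳ-≤ 2 t≥1) (large-2 t) above
theorem1p3 (suc (suc zero)) k t (s≤s (s≤s ()))
theorem1p3 (suc zero) k t (s≤s ())
theorem1p3 zero k t ()
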